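{- Let $(W,\mathcal{S})$ be a finite Coxeter system and $m\ge 0$ an integer. The $m$-weak order $\mathrm{Weak}^{(m)}(W)=[e,w_\circ^m]$ (an interval in the right weak order of the positive Artin monoid $B^+(W)$) is a lattice which is rank-symmetric and self-dual (i.e. anti-isomorphic to itself).
   Context: $(W,\mathcal{S})$ is a finite Coxeter system with Coxeter matrix $m(s,t)$. The positive Artin monoid $B^+=B^+(W)$ is the monoid generated by (a formal copy of) $\mathcal{S}$ subject only to the braid relations $sts\cdots=tst\cdots$ (both sides with $m(s,t)$ factors) for $s\ne t$. All words representing a given $w\in B^+$ have the same length $\ell(w)$. The right weak order on $B^+$ is $u\le w$ iff there is $v\in B^+$ with $uv=w$ (then $\ell(u)+\ell(v)=\ell(w)$). $w_\circ$ denotes the longest element of $W$, viewed in $B^+$ via any reduced word; $N=\ell(w_\circ)$. $\mathrm{Weak}^{(m)}(W)$ is the interval $\{w\in B^+: w\le w_\circ^m\}$ with the induced order; it is graded by $\ell$ with ranks $0,\dots,mN$, and rank-symmetric means the number of elements of length $i$ equals the number of elements of length $mN-i$ for all $i$. -}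

module Defs where

open import Data.Nat using (ℕ; zero; suc; _≤_; _*_; _∸_)
open import Data.Fin using (Fin)
open import Data.List using (List; []; _∷_; _++_; length; concat; replicate)
open import Data.List.Relation.Unary.Any using (Any)
open import Data.Product using (Σ; _×_; _,_; proj₁)
open import Relation.Binary.PropositionalEquality using (_≡_; _≢_)
open import Relation.Binary.Bundles using (Setoid)
open import Function.Bundles using (Bijection; _⇔_)
open import Level using (0ℓ)

-- A Coxeter matrix on the generating set S = Fin n.
-- (For a finite Coxeter system all entries m(s,t) are finite, so ℕ-valued entries suffice.)
record CoxeterMatrix (n : ℕ) : Set where
  field
    m     : Fin n → Fin n → ℕ
    diag  : ∀ s → m s s ≡ 1
    symm  : ∀ s t → m s t ≡ m t s
    off   : ∀ s t → s ≢ t → 2 ≤ m s t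

Word : ℕ → Set
Word n = List (Fin n)

alt : ∀ {n} → Fin n → Fin n → ℕ → Word n
alt s t zero    = []
alt s t (suc k) = s ∷ alt t s k

power : ∀ {n} → Word n → ℕ → Word n
power w k = concat (replicate k w)

module Coxeter {n : ℕ} (M : CoxeterMatrix n) where
  open CoxeterMatrix M

  -- equality in the positive Artin monoid B⁺(W): congruence generated by braid relations
  data _≈B_ : Word n → Word n → Set where
    braid  : ∀ u v s t → s ≢ t →
             (u ++ alt s t (m s t) ++ v) ≈B (u ++ alt t s (m s t) ++ v)
    reflB  : ∀ {w} → w ≈B w
    symB   : ∀ {u v} → u ≈B v → v ≈B u
    transB : ∀ {u v w} → u ≈B v → v ≈B w → u ≈B w

  -- equality in the Coxeter group W: braid relations plus s² = e
  data _≈W_ : Word n → Word n → Set where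
    braidW  : ∀ u v s t → s ≢ t →
              (u ++ alt s t (m s t) ++ v) ≈W (u ++ alt t s (m s t) ++ v)
    square  : ∀ u v s → (u ++ s ∷ s ∷ v) ≈W (u ++ v)
    reflW   : ∀ {w} → w ≈W w
    symW    : ∀ {u v} → u ≈W v → v ≈W u
    transW  : ∀ {u v w} → u ≈W v → v ≈W w → u ≈W w

  IsFiniteW : Set
  IsFiniteW = Σ (List (Word n)) λ L → ∀ w → Any (λ u → w ≈W u) L

  IsReduced : Word n → Set
  IsReduced w = ∀ v → v ≈W w → length w ≤ length v

  IsLongestReduced : Word n → Set
  IsLongestReduced w = IsReduced w × (∀ u → IsReduced u → length u ≤ length w)

  _≼_ : Word n → Word n → Set
  u ≼ w = Σ (Word n) λ v → (u ++ v) ≈B w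

  module Interval (w0 : Word n) (k : ℕ) where
    top : Word n
    top = power w0 k

    InWeak : Word n → Set
    InWeak w = w ≼ top

    Elt : Set
    Elt = Σ (Word n) InWeak

    HasMeet : Word n → Word n → Set
    HasMeet a b = Σ (Word n) λ c → InWeak c × c ≼ a × c ≼ b ×
                  (∀ d → InWeak d → d ≼ a → d ≼ b → d ≼ c)

    HasJoin : Word n → Word n → Set
    HasJoin a b = Σ (Word n) λ c → InWeak c × a ≼ c × b ≼ c ×
                  (∀ d → InWeak d → a ≼ d → b ≼ d → c ≼ d)

    IsLattice : Set
    IsLattice = ∀ a b → InWeak a → InWeak b → HasMeet a b × HasJoin a b

    Level : ℕ → Setoid 0ℓ 0ℓ
    Level i = record
      { Carrier = Σ (Word n) λ w → InWeak w × length w ≡ i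
      ; _≈_ = λ x y → proj₁ x ≈B proj₁ y
      ; isEquivalence = record { refl = reflB ; sym = symB ; trans = transB }
      }

    rank : ℕ
    rank = k * length w0

    RankSymmetric : Set
    RankSymmetric = ∀ i → i ≤ rank → Bijection (Level i) (Level (rank ∸ i))

    SelfDual : Set
    SelfDual = Σ (Elt → Elt) λ φ →
      (∀ (x y : Elt) → proj₁ x ≈B proj₁ y → proj₁ (φ x) ≈B proj₁ (φ y)) ×
      (∀ (x y : Elt) → proj₁ (φ x) ≈B proj₁ (φ y) → proj₁ x ≈B proj₁ y) ×
      (∀ (y : Elt) → Σ Elt λ x → proj₁ (φ x) ≈B proj₁ y) ×
      (∀ (x y : Elt) → (proj₁ x ≼ proj₁ y) ⇔ (proj₁ (φ y) ≼ proj₁ (φ x)))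

{-# OPTIONS --safe #-}
-- Everything rests on the reduction lemma: if s u = t v in B⁺ with s ≠ t, then both are multiples of
-- lcm(s,t) = sts⋯ (m(s,t) factors); and s u = s v implies u = v. For reduced words it follows from the exchange
-- condition (Bourbaki's parity count of reflections) once s t is known to have order exactly m(s,t) in W, which
-- is read off a reflection representation. In general it is proved by induction on the length: for a chain
-- s u = r y = t v, the lcm D of the two complements of r is computed at smaller length, and r D divides the
-- longest element, so the comparison of s and t takes place among reduced words.
-- The reduction lemma gives cancellation, lcms of elements with a common multiple and gcds, hence the lattice.
-- Since the longest element is unique it is equal to its reversal, and x ↦ reverse (x⁻¹ w₀ᵏ) is the anti-automorphism.
-- Constructively, equality in W is decidable only up to double negation; this is harmless because
-- equality and divisibility in B⁺ are decidable.
module Submission where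

open import Defs
open import Data.Bool.Base using (Bool; true; false; not; _xor_)
open import Data.Bool.Properties using (xor-assoc; xor-comm; xor-same)
open import Data.Empty using (⊥)
open import Data.Fin.Base using (Fin)
open import Data.Fin.Properties using (_≟_; any?)
open import Data.Integer.Base using (ℤ; 0ℤ; 1ℤ; _+_; _-_; -_)
import Data.Integer.Properties as ℤₚ
open import Data.Integer.Tactic.RingSolver using () renaming (solve-∀ to ℤ-solve)
open import Data.List.Base using (List; []; _∷_; _++_; [_]; _∷ʳ_; length; reverse; drop; map; concatMap; allFin)
open import Data.List.Membership.Propositional using (_∈_; lose; find)
open import Data.List.Membership.Propositional.Properties using (∈-map⁺; ∈-concatMap⁺; ∈-allFin)
open import Data.List.Properties using (++-assoc; ++-identityʳ; length-++; length-reverse; unfold-reverse; reverse-++; reverse-involutive; ≡-dec)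
open import Data.List.Relation.Unary.All as All using (All; []; _∷_)
open import Data.List.Relation.Unary.Any as Any using (Any; here; there)
open import Data.Nat.Base as ℕ using (ℕ; zero; suc; _≤_; _<_; _∸_; z≤n; s≤s; z<s; s<s)
open import Data.Nat.Divisibility using (divides-refl)
open import Data.Nat.DivMod using (_/_; _%_; m≡m%n+[m/n]*n; m%n<n; [m+kn]%n≡m%n; m<n⇒m%n≡m; m<n⇒m/n≡0; m*n/n≡m; +-distrib-/-∣ʳ)
import Data.Nat.Properties as ℕₚ
open import Data.Nat.Tactic.RingSolver using () renaming (solve-∀ to ℕ-solve)
open import Data.Product using (_×_; _,_; proj₁; proj₂; ∃; ∃₂)
open import Data.Sum.Base using (_⊎_; inj₁; inj₂) renaming (swap to ⊎-swap)
open import Data.Unit.Base using (⊤; tt)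
open import Function.Bundles using (mk⇔)
open import Relation.Binary.Definitions using (DecidableEquality)
open import Relation.Binary.PropositionalEquality hiding ([_])
open import Relation.Nullary using (¬_; Dec; yes; no; does; contradiction)
open import Relation.Nullary.Decidable using (map′; _×-dec_; _⊎-dec_; ¬?; decidable-stable; does-⇔; dec-true; dec-false; ¬¬-excluded-middle)
open import Algebra.Properties.AbelianGroup ℤₚ.+-0-abelianGroup using () renaming (∙-cancelˡ to +-cancelˡ; ∙-cancelʳ to +-cancelʳ)

-- Waves on a discrete strip

-- The reflection representation calls for the numbers 2cos(π/m), which are in general not integers.
-- But 2cos(π/m) is an eigenvalue of the path with m - 1 vertices, so it is replaced by the integral
-- adjacency operator of such paths. Different pairs of generators need paths of different lengths
-- acting on one space; this space is ℕ → ℤ, cut into blocks. Powers of st then follow a Chebyshev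
-- recurrence, which is the discrete wave equation between two reflecting walls. Travelling waves
-- show that (st)^m acts trivially, and a single travelling pulse shows that no smaller positive
-- power does. The obstacle in the reduction lemma is a chain through three distinct letters s, r,
-- t, classically settled by looking at the finite groups of rank three. Here no classification
-- enters: one longest element is a common multiple of lcm(s,r) and lcm(r,t), and this confines the
-- comparison to its divisors. Lcms are needed twice, inside this induction, where the reduction
-- lemma is available only for some words, and afterwards for all words; hence their construction is
-- relative to a class of words.

Σ< : ℕ → (ℕ → ℤ) → ℤ
Σ< zero    g = 0ℤ
Σ< (suc k) g = Σ< k g + g k

Σ<-cong : ∀ k {g h : ℕ → ℤ} → g ≗ h → Σ< k g ≡ Σ< k h
Σ<-cong zero    g≗h = refl
Σ<-cong (suc k) g≗h = cong₂ _+_ (Σ<-cong k g≗h) (g≗h k)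

Σ<-- : ∀ k (g h : ℕ → ℤ) → Σ< k (λ i → g i - h i) ≡ Σ< k g - Σ< k h
Σ<-- zero    g h = refl
Σ<-- (suc k) g h = trans (cong (_+ (g k - h k)) (Σ<-- k g h)) (ring (Σ< k g) (Σ< k h) (g k) (h k))
  where
  ring : ∀ a b c d → (a - b) + (c - d) ≡ (a + c) - (b + d)
  ring = ℤ-solve

Σ<-shift : ∀ k (g : ℕ → ℤ) → Σ< k (λ i → g (suc i)) + g 0 ≡ Σ< (suc k) g
Σ<-shift zero    g = refl
Σ<-shift (suc k) g = trans (ring (Σ< k (λ i → g (suc i))) (g (suc k)) (g 0)) (cong (_+ g (suc k)) (Σ<-shift k g))
  where
  ring : ∀ a b c → (a + b) + c ≡ (a + c) + b
  ring = ℤ-solve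

Σ<-periodic : ∀ m (g : ℕ → ℤ) → (∀ i → g (m ℕ.+ i) ≡ g i) → ∀ c → Σ< m (λ i → g (c ℕ.+ i)) ≡ Σ< m g
Σ<-periodic m g per zero    = refl
Σ<-periodic m g per (suc c) = trans shifted (Σ<-periodic m g per c)
  where
  h : ℕ → ℤ
  h i = g (c ℕ.+ i)
  hm≡h0 : h m ≡ h 0
  hm≡h0 = trans (cong g (trans (ℕₚ.+-comm c m) (cong (m ℕ.+_) (sym (ℕₚ.+-identityʳ c))))) (per (c ℕ.+ 0))
  shifted : Σ< m (λ i → g (suc c ℕ.+ i)) ≡ Σ< m h
  shifted = +-cancelʳ (h 0) _ _ (begin
    Σ< m (λ i → g (suc c ℕ.+ i)) + h 0  ≡⟨ cong (_+ h 0) (Σ<-cong m (λ i → cong g (sym (ℕₚ.+-suc c i)))) ⟩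
    Σ< m (λ i → h (suc i)) + h 0        ≡⟨ Σ<-shift m h ⟩
    Σ< m h + h m                        ≡⟨ cong (Σ< m h +_) hm≡h0 ⟩
    Σ< m h + h 0                        ∎)
    where
    open ≡-Reasoning

-- A wave vanishing on the two sides of the strip 0 ≤ i ≤ m has the form
-- f k i = φ (k + i) − φ (k − i) with φ periodic of period 2m.
module Wave (m : ℕ) (f : ℕ → ℕ → ℤ)
  (left  : ∀ k → f k 0 ≡ 0ℤ)
  (right : ∀ k → f k m ≡ 0ℤ)
  (wave  : ∀ k j → suc j < m → f (2 ℕ.+ k) (suc j) + f k (suc j) ≡ f (suc k) j + f (suc k) (2 ℕ.+ j))
  where

  -- Next to the left wall the formula reads f (k + 1) 1 = φ (k + 2) - φ k, which determines `φ` up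
  -- to one constant for each parity; both constants are set to zero.
  φ : ℕ → ℤ
  φ 0             = 0ℤ
  φ 1             = 0ℤ
  φ (suc (suc k)) = φ k + f (suc k) 1

  -- Induction on the position: the wave equation determines position i + 2 from positions i and i +
  -- 1. The time is written i + d, so that the argument k - i of the reflected wave is `d` and no
  -- truncated subtraction occurs.
  f≡Δφ : ∀ i d → i ≤ m → f (i ℕ.+ d) i ≡ φ (i ℕ.+ i ℕ.+ d) - φ d
  f≡Δφ zero d _ = trans (left d) (sym (ℤₚ.+-inverseʳ (φ d)))
  f≡Δφ (suc zero) d _ = ring (f (suc d) 1) (φ d)
    where
    ring : ∀ a b → a ≡ (b + a) - b
    ring = ℤ-solve
  f≡Δφ (suc (suc i)) d 2+i≤m = ring _ (φ (2 ℕ.+ i ℕ.+ (2 ℕ.+ i) ℕ.+ d)) (φ (2 ℕ.+ d)) (φ (i ℕ.+ i ℕ.+ (2 ℕ.+ d))) (φ d) (wave (suc i ℕ.+ d) i 2+i≤m)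
      (trans (cong (λ k → f k (suc i)) (idx₁ i d))
             (trans (f≡Δφ (suc i) (2 ℕ.+ d) 1+i≤m) (cong (λ k → φ k - φ (2 ℕ.+ d)) (idx₂ i d))))
      (trans (f≡Δφ (suc i) d 1+i≤m) (cong (λ k → φ k - φ d) (idx₃ i d)))
      (trans (cong (λ k → f k i) (idx₄ i d)) (f≡Δφ i (2 ℕ.+ d) i≤m))
    where
    1+i≤m : suc i ≤ m
    1+i≤m = ℕₚ.≤-trans (ℕₚ.n≤1+n _) 2+i≤m
    i≤m : i ≤ m
    i≤m = ℕₚ.≤-trans (ℕₚ.n≤1+n _) 1+i≤m
    idx₁ : ∀ i d → 3 ℕ.+ i ℕ.+ d ≡ suc i ℕ.+ (2 ℕ.+ d)
    idx₁ = ℕ-solve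
    idx₂ : ∀ i d → suc i ℕ.+ suc i ℕ.+ (2 ℕ.+ d) ≡ 2 ℕ.+ i ℕ.+ (2 ℕ.+ i) ℕ.+ d
    idx₂ = ℕ-solve
    idx₃ : ∀ i d → suc i ℕ.+ suc i ℕ.+ d ≡ i ℕ.+ i ℕ.+ (2 ℕ.+ d)
    idx₃ = ℕ-solve
    idx₄ : ∀ i d → 2 ℕ.+ i ℕ.+ d ≡ i ℕ.+ (2 ℕ.+ d)
    idx₄ = ℕ-solve
    ring : ∀ {a b c} e p q r s → a + b ≡ c + e → a ≡ p - q → b ≡ r - s → c ≡ r - q → e ≡ p - s
    ring {a} {b} {c} e p q r s eq refl refl refl = +-cancelˡ (r - q) _ _ (trans (sym eq) (ring′ p q r s))
      where
      ring′ : ∀ p q r s → (p - q) + (r - s) ≡ (r - q) + (p - s)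
      ring′ = ℤ-solve

  φ-periodic : ∀ d → φ (m ℕ.+ m ℕ.+ d) ≡ φ d
  φ-periodic d = ℤₚ.i-j≡0⇒i≡j (φ (m ℕ.+ m ℕ.+ d)) (φ d) (trans (sym (f≡Δφ m d ℕₚ.≤-refl)) (right _))

  f-periodic : ∀ i d → i ≤ m → f (m ℕ.* 2 ℕ.+ (i ℕ.+ d)) i ≡ f (i ℕ.+ d) i
  f-periodic i d i≤m = begin
      f (m ℕ.* 2 ℕ.+ (i ℕ.+ d)) i                           ≡⟨ cong (λ k → f k i) (idx₁ m i d) ⟩
      f (i ℕ.+ (m ℕ.+ m ℕ.+ d)) i                           ≡⟨ f≡Δφ i (m ℕ.+ m ℕ.+ d) i≤m ⟩
      φ (i ℕ.+ i ℕ.+ (m ℕ.+ m ℕ.+ d)) - φ (m ℕ.+ m ℕ.+ d)   ≡⟨ cong₂ _-_ (trans (cong φ (idx₂ m i d)) (φ-periodic (i ℕ.+ i ℕ.+ d))) (φ-periodic d) ⟩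
      φ (i ℕ.+ i ℕ.+ d) - φ d                               ≡⟨ f≡Δφ i d i≤m ⟨
      f (i ℕ.+ d) i                                         ∎
    where
    open ≡-Reasoning
    idx₁ : ∀ m i d → m ℕ.* 2 ℕ.+ (i ℕ.+ d) ≡ i ℕ.+ (m ℕ.+ m ℕ.+ d)
    idx₁ = ℕ-solve
    idx₂ : ∀ m i d → i ℕ.+ i ℕ.+ (m ℕ.+ m ℕ.+ d) ≡ m ℕ.+ m ℕ.+ (i ℕ.+ i ℕ.+ d)
    idx₂ = ℕ-solve

  -- At every second time the formula reads g (i + j) - g j with g of period m, and shifting the
  -- summation by i does not change the sum over a period.
  f-sum : ∀ i d → i ≤ m → Σ< m (λ j → f (j ℕ.* 2 ℕ.+ (i ℕ.+ d)) i) ≡ 0ℤ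
  f-sum i d i≤m = begin
      Σ< m (λ j → f (j ℕ.* 2 ℕ.+ (i ℕ.+ d)) i)  ≡⟨ Σ<-cong m (λ j → trans (cong (λ k → f k i) (idx₁ i d j)) (trans (f≡Δφ i (j ℕ.* 2 ℕ.+ d) i≤m) (cong (λ k → φ k - g j) (idx₂ i d j)))) ⟩
      Σ< m (λ j → g (i ℕ.+ j) - g j)            ≡⟨ Σ<-- m (λ j → g (i ℕ.+ j)) g ⟩
      Σ< m (λ j → g (i ℕ.+ j)) - Σ< m g         ≡⟨ cong (_- Σ< m g) (Σ<-periodic m g g-periodic i) ⟩
      Σ< m g - Σ< m g                           ≡⟨ ℤₚ.+-inverseʳ (Σ< m g) ⟩
      0ℤ                                        ∎
    where
    open ≡-Reasoning
    g : ℕ → ℤ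
    g j = φ (j ℕ.* 2 ℕ.+ d)
    idx₁ : ∀ i d j → j ℕ.* 2 ℕ.+ (i ℕ.+ d) ≡ i ℕ.+ (j ℕ.* 2 ℕ.+ d)
    idx₁ = ℕ-solve
    idx₂ : ∀ i d j → i ℕ.+ i ℕ.+ (j ℕ.* 2 ℕ.+ d) ≡ (i ℕ.+ j) ℕ.* 2 ℕ.+ d
    idx₂ = ℕ-solve
    idx₃ : ∀ m i d → (m ℕ.+ i) ℕ.* 2 ℕ.+ d ≡ m ℕ.+ m ℕ.+ (i ℕ.* 2 ℕ.+ d)
    idx₃ = ℕ-solve
    g-periodic : ∀ i → g (m ℕ.+ i) ≡ g i
    g-periodic i = trans (cong φ (idx₃ m i d)) (φ-periodic (i ℕ.* 2 ℕ.+ d))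

-- The adjacency operator of a disjoint union of paths

-- ℕ is cut into consecutive blocks of length p; strip p g q is the restriction of g to block q,
-- moved to the positions 1, …, p and extended by zero.
strip : ℕ → (ℕ → ℤ) → ℕ → ℕ → ℤ
strip p g q zero = 0ℤ
strip p g q (suc j) with j ℕₚ.<? p
... | yes _ = g (j ℕ.+ q ℕ.* p)
... | no  _ = 0ℤ

strip-in : ∀ p g q j → j < p → strip p g q (suc j) ≡ g (j ℕ.+ q ℕ.* p)
strip-in p g q j j<p with j ℕₚ.<? p
... | yes _   = refl
... | no  j≮p = contradiction j<p j≮p

strip-out : ∀ p g q → strip p g q (suc p) ≡ 0ℤ
strip-out p g q with p ℕₚ.<? p
... | yes p<p = contradiction p<p (ℕₚ.<-irrefl refl)
... | no  _   = refl

strip-cong : ∀ p {g h} → g ≗ h → ∀ q j → strip p g q j ≡ strip p h q j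
strip-cong p g≗h q zero = refl
strip-cong p g≗h q (suc j) with j ℕₚ.<? p
... | yes _ = g≗h _
... | no  _ = refl

strip-+ : ∀ p g h q j → strip p (λ x → g x + h x) q j ≡ strip p g q j + strip p h q j
strip-+ p g h q zero = refl
strip-+ p g h q (suc j) with j ℕₚ.<? p
... | yes _ = refl
... | no  _ = refl

strip-- : ∀ p g h q j → strip p (λ x → g x - h x) q j ≡ strip p g q j - strip p h q j
strip-- p g h q zero = refl
strip-- p g h q (suc j) with j ℕₚ.<? p
... | yes _ = refl
... | no  _ = refl

strip-read : ∀ e g x → g x ≡ strip (suc e) g (x / suc e) (suc (x % suc e))
strip-read e g x = trans (cong g (m≡m%n+[m/n]*n x (suc e))) (sym (strip-in (suc e) g _ _ (m%n<n x (suc e))))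

-- Plays the role of multiplication by 2cos(π/m) for m = 2 + e.
Adj : ℕ → (ℕ → ℤ) → (ℕ → ℤ)
Adj e g x = strip (suc e) g (x / suc e) (x % suc e) + strip (suc e) g (x / suc e) (2 ℕ.+ x % suc e)

strip-Adj : ∀ e g q j → j < suc e →
            strip (suc e) (Adj e g) q (suc j) ≡ strip (suc e) g q j + strip (suc e) g q (2 ℕ.+ j)
strip-Adj e g q j j<p = trans (strip-in (suc e) (Adj e g) q j j<p)
  (cong₂ (λ a b → strip (suc e) g a b + strip (suc e) g a (2 ℕ.+ b)) quot rem)
  where
  rem : (j ℕ.+ q ℕ.* suc e) % suc e ≡ j
  rem = trans ([m+kn]%n≡m%n j q (suc e)) (m<n⇒m%n≡m j<p)
  quot : (j ℕ.+ q ℕ.* suc e) / suc e ≡ q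
  quot = trans (+-distrib-/-∣ʳ j (divides-refl q)) (cong₂ ℕ._+_ (m<n⇒m/n≡0 j<p) (m*n/n≡m q (suc e)))

Adj-cong : ∀ e {g h} → g ≗ h → Adj e g ≗ Adj e h
Adj-cong e g≗h x = cong₂ _+_ (strip-cong (suc e) g≗h (x / suc e) (x % suc e)) (strip-cong (suc e) g≗h (x / suc e) (2 ℕ.+ x % suc e))

Adj-+ : ∀ e g h → Adj e (λ x → g x + h x) ≗ (λ x → Adj e g x + Adj e h x)
Adj-+ e g h x = trans (cong₂ _+_ (strip-+ (suc e) g h (x / suc e) (x % suc e)) (strip-+ (suc e) g h (x / suc e) (2 ℕ.+ x % suc e)))
                      (ring (strip (suc e) g (x / suc e) (x % suc e)) (strip (suc e) h (x / suc e) (x % suc e)) _ _)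
  where
  ring : ∀ a b c d → (a + b) + (c + d) ≡ (a + c) + (b + d)
  ring = ℤ-solve

Adj-- : ∀ e g h → Adj e (λ x → g x - h x) ≗ (λ x → Adj e g x - Adj e h x)
Adj-- e g h x = trans (cong₂ _+_ (strip-- (suc e) g h (x / suc e) (x % suc e)) (strip-- (suc e) g h (x / suc e) (2 ℕ.+ x % suc e)))
                      (ring (strip (suc e) g (x / suc e) (x % suc e)) (strip (suc e) h (x / suc e) (x % suc e)) _ _)
  where
  ring : ∀ a b c d → (a - b) + (c - d) ≡ (a + c) - (b + d)
  ring = ℤ-solve

Adj-0 : ∀ e → Adj e (λ _ → 0ℤ) ≗ (λ _ → 0ℤ)
Adj-0 e x = trans (Adj-- e (λ _ → 0ℤ) (λ _ → 0ℤ) x) (ℤₚ.+-inverseʳ (Adj e (λ _ → 0ℤ) x))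

-- With 2cosθ in place of `Adj` this is the Chebyshev recurrence, solved by sin kθ; `k` is the time
-- of the wave.
cheb : ℕ → (a b : ℕ → ℤ) → ℕ → ℕ → ℤ
cheb e a b 0             = a
cheb e a b 1             = b
cheb e a b (suc (suc k)) = λ x → Adj e (cheb e a b (suc k)) x - cheb e a b k x

cheb-rewind₁ : ∀ e a b k → cheb e (λ x → Adj e a x - b x) a (suc k) ≗ cheb e a b k
cheb-rewind₁ e a b zero          x = refl
cheb-rewind₁ e a b (suc zero)    x = ring (Adj e a x) (b x)
  where
  ring : ∀ a b → a - (a - b) ≡ b
  ring = ℤ-solve
cheb-rewind₁ e a b (suc (suc k)) x =
  cong₂ _-_ (Adj-cong e (cheb-rewind₁ e a b (suc k)) x) (cheb-rewind₁ e a b k x)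

-- The oldest term has coefficient -1, so the recurrence also runs backwards over ℤ.
cheb-rewind : ∀ e a b j → ∃₂ λ a′ b′ → ∀ k → cheb e a′ b′ (j ℕ.+ k) ≗ cheb e a b k
cheb-rewind e a b zero = a , b , λ k x → refl
cheb-rewind e a b (suc j) with cheb-rewind e a b j
... | a′ , b′ , eq = (λ x → Adj e a′ x - b′ x) , a′ , λ k x → trans (cheb-rewind₁ e a′ b′ (j ℕ.+ k) x) (eq k x)

strip-cheb : ∀ e a b q k j → suc j < 2 ℕ.+ e →
             strip (suc e) (cheb e a b (2 ℕ.+ k)) q (suc j) + strip (suc e) (cheb e a b k) q (suc j)
             ≡ strip (suc e) (cheb e a b (suc k)) q j + strip (suc e) (cheb e a b (suc k)) q (2 ℕ.+ j)
strip-cheb e a b q k j (s≤s j<p) = trans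
  (cong (_+ strip (suc e) (cheb e a b k) q (suc j))
    (trans (strip-- (suc e) (Adj e (cheb e a b (suc k))) (cheb e a b k) q (suc j))
           (cong (_- strip (suc e) (cheb e a b k) q (suc j)) (strip-Adj e (cheb e a b (suc k)) q j j<p))))
  (ring (strip (suc e) (cheb e a b (suc k)) q j) _ _)
  where
  ring : ∀ a b c → ((a + b) - c) + c ≡ a + b
  ring = ℤ-solve

module ChebWave (e : ℕ) (a b : ℕ → ℤ) (q : ℕ) =
  Wave (2 ℕ.+ e) (λ k i → strip (suc e) (cheb e a b k) q i) (λ k → refl) (λ k → strip-out (suc e) (cheb e a b k) q)
       (strip-cheb e a b q)

module _ (e : ℕ) where
  private
    m : ℕ
    m = 2 ℕ.+ e

    position≤m : ∀ x → suc (x % suc e) ≤ m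
    position≤m x = ℕₚ.m≤n⇒m≤1+n (m%n<n x (suc e))

    -- The wave formula holds only from time i on at position i, so waves are first rewound by m steps.
    delay : ∀ x k → m ℕ.+ k ≡ suc (x % suc e) ℕ.+ (m ∸ suc (x % suc e) ℕ.+ k)
    delay x k = trans (cong (ℕ._+ k) (sym (ℕₚ.m+[n∸m]≡n (position≤m x)))) (ℕₚ.+-assoc (suc (x % suc e)) _ k)

  cheb-periodic : ∀ a b k → cheb e a b (m ℕ.* 2 ℕ.+ k) ≗ cheb e a b k
  cheb-periodic a b k x with cheb-rewind e a b m
  ... | a′ , b′ , eq = begin
      cheb e a b (m ℕ.* 2 ℕ.+ k) x                            ≡⟨ eq (m ℕ.* 2 ℕ.+ k) x ⟨
      cheb e a′ b′ (m ℕ.+ (m ℕ.* 2 ℕ.+ k)) x                  ≡⟨ strip-read e (cheb e a′ b′ (m ℕ.+ (m ℕ.* 2 ℕ.+ k))) x ⟩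
      strip (suc e) (cheb e a′ b′ (m ℕ.+ (m ℕ.* 2 ℕ.+ k))) q i  ≡⟨ cong (λ k → strip (suc e) (cheb e a′ b′ k) q i) (trans (swap m k) (cong (m ℕ.* 2 ℕ.+_) (delay x k))) ⟩
      strip (suc e) (cheb e a′ b′ (m ℕ.* 2 ℕ.+ (i ℕ.+ d))) q i  ≡⟨ ChebWave.f-periodic e a′ b′ q i d (position≤m x) ⟩
      strip (suc e) (cheb e a′ b′ (i ℕ.+ d)) q i              ≡⟨ cong (λ k → strip (suc e) (cheb e a′ b′ k) q i) (delay x k) ⟨
      strip (suc e) (cheb e a′ b′ (m ℕ.+ k)) q i              ≡⟨ strip-read e (cheb e a′ b′ (m ℕ.+ k)) x ⟨
      cheb e a′ b′ (m ℕ.+ k) x                                ≡⟨ eq k x ⟩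
      cheb e a b k x                                          ∎
    where
    open ≡-Reasoning
    q i d : ℕ
    q = x / suc e
    i = suc (x % suc e)
    d = m ∸ i ℕ.+ k
    swap : ∀ m k → m ℕ.+ (m ℕ.* 2 ℕ.+ k) ≡ m ℕ.* 2 ℕ.+ (m ℕ.+ k)
    swap = ℕ-solve

  cheb-sum : ∀ a b k x → Σ< m (λ j → cheb e a b (j ℕ.* 2 ℕ.+ k) x) ≡ 0ℤ
  cheb-sum a b k x with cheb-rewind e a b m
  ... | a′ , b′ , eq = trans (Σ<-cong m term) (ChebWave.f-sum e a′ b′ q i d (position≤m x))
    where
    open ≡-Reasoning
    q i d : ℕ
    q = x / suc e
    i = suc (x % suc e)
    d = m ∸ i ℕ.+ k
    swap : ∀ m j k → m ℕ.+ (j ℕ.* 2 ℕ.+ k) ≡ j ℕ.* 2 ℕ.+ (m ℕ.+ k)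
    swap = ℕ-solve
    term : ∀ j → cheb e a b (j ℕ.* 2 ℕ.+ k) x ≡ strip (suc e) (cheb e a′ b′ (j ℕ.* 2 ℕ.+ (i ℕ.+ d))) q i
    term j = begin
      cheb e a b (j ℕ.* 2 ℕ.+ k) x                            ≡⟨ eq (j ℕ.* 2 ℕ.+ k) x ⟨
      cheb e a′ b′ (m ℕ.+ (j ℕ.* 2 ℕ.+ k)) x                  ≡⟨ strip-read e (cheb e a′ b′ (m ℕ.+ (j ℕ.* 2 ℕ.+ k))) x ⟩
      strip (suc e) (cheb e a′ b′ (m ℕ.+ (j ℕ.* 2 ℕ.+ k))) q i  ≡⟨ cong (λ k → strip (suc e) (cheb e a′ b′ k) q i) (trans (swap m j k) (cong (j ℕ.* 2 ℕ.+_) (delay x k))) ⟩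
      strip (suc e) (cheb e a′ b′ (j ℕ.* 2 ℕ.+ (i ℕ.+ d))) q i  ∎

-- A pulse released next to the left wall

δ₀ : ℕ → ℤ
δ₀ zero    = 1ℤ
δ₀ (suc x) = 0ℤ

module Pulse (e : ℕ) where
  private
    m : ℕ
    m = 2 ℕ.+ e

    f : ℕ → ℕ → ℤ
    f k i = strip (suc e) (cheb e (λ _ → 0ℤ) δ₀ k) 0 i

  diagonal : ℕ → ℕ → ℤ
  diagonal zero    zero    = 1ℤ
  diagonal zero    (suc i) = 0ℤ
  diagonal (suc k) zero    = 0ℤ
  diagonal (suc k) (suc i) = diagonal k i

  diagonal-< : ∀ {k i} → k < i → diagonal k i ≡ 0ℤ
  diagonal-< {zero}  (s≤s _)   = refl
  diagonal-< {suc k} (s≤s k<i) = diagonal-< k<i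

  diagonal-refl : ∀ k → diagonal k k ≡ 1ℤ
  diagonal-refl zero    = refl
  diagonal-refl (suc k) = diagonal-refl k

  -- Time 0 is separate because the initial state is zero there, whereas the diagonal has a 1 on the
  -- wall at that time.
  pulse : ℕ → ℕ → ℤ
  pulse zero    i = 0ℤ
  pulse (suc k) i = diagonal (suc k) i

  pulse-wave : ∀ k j → pulse (suc k) j + pulse (suc k) (2 ℕ.+ j) ≡ pulse (2 ℕ.+ k) (suc j) + pulse k (suc j)
  pulse-wave zero    zero    = refl
  pulse-wave zero    (suc j) = refl
  pulse-wave (suc k) zero    = refl
  pulse-wave (suc k) (suc j) = refl

  f-m : ∀ k → f k m ≡ 0ℤ
  f-m k = strip-out (suc e) (cheb e (λ _ → 0ℤ) δ₀ k) 0

  -- The free pulse reaches the far wall only at time m; before that, both it and the true wave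
  -- vanish there.
  at-wall : ∀ k i → k < m → i ≤ m → (i < m → f k i ≡ pulse k i) → f k i ≡ pulse k i
  at-wall k i k<m i≤m below with i ℕₚ.≟ m
  at-wall zero    i k<m i≤m below | yes refl = f-m zero
  at-wall (suc k) i k<m i≤m below | yes refl = trans (f-m (suc k)) (sym (diagonal-< k<m))
  at-wall k       i k<m i≤m below | no  i≢m  = below (ℕₚ.≤∧≢⇒< i≤m i≢m)

  f≡pulse : ∀ k i → k ≤ m → i < m → f k i ≡ pulse k i
  f≡pulse zero          zero    k≤m i<m = refl
  f≡pulse zero          (suc j) k≤m (s≤s j<p) = strip-in (suc e) (λ _ → 0ℤ) 0 j j<p
  f≡pulse (suc zero)    zero    k≤m i<m = refl
  f≡pulse (suc zero)    (suc zero) k≤m (s≤s j<p) = strip-in (suc e) δ₀ 0 0 j<p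
  f≡pulse (suc zero)    (suc (suc j)) k≤m (s≤s j<p) = strip-in (suc e) δ₀ 0 (suc j) j<p
  f≡pulse (suc (suc k)) zero    k≤m i<m = refl
  f≡pulse (suc (suc k)) (suc j) k≤m i<m = +-cancelʳ (f k (suc j)) _ _ (begin
    f (2 ℕ.+ k) (suc j) + f k (suc j)              ≡⟨ strip-cheb e (λ _ → 0ℤ) δ₀ 0 k j i<m ⟩
    f (suc k) j + f (suc k) (2 ℕ.+ j)              ≡⟨ cong₂ _+_ (f≡pulse (suc k) j 1+k≤m (ℕₚ.<-trans (ℕₚ.n<1+n j) i<m)) (at-wall (suc k) (2 ℕ.+ j) k≤m i<m (f≡pulse (suc k) (2 ℕ.+ j) 1+k≤m)) ⟩
    pulse (suc k) j + pulse (suc k) (2 ℕ.+ j)      ≡⟨ pulse-wave k j ⟩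
    pulse (2 ℕ.+ k) (suc j) + pulse k (suc j)      ≡⟨ cong (pulse (2 ℕ.+ k) (suc j) +_) (f≡pulse k (suc j) (ℕₚ.≤-trans (ℕₚ.n≤1+n k) 1+k≤m) i<m) ⟨
    pulse (2 ℕ.+ k) (suc j) + f k (suc j)          ∎)
    where
    open ≡-Reasoning
    1+k≤m : suc k ≤ m
    1+k≤m = ℕₚ.≤-trans (ℕₚ.n≤1+n _) k≤m

  -- At time m the pulse has just vanished at the wall and is about to return with the opposite sign.
  cheb-aperiodic : ∀ k → 1 ≤ k → k ≤ m →
                   cheb e (λ _ → 0ℤ) δ₀ k ≗ (λ _ → 0ℤ) → cheb e (λ _ → 0ℤ) δ₀ (suc k) ≗ δ₀ → ⊥
  cheb-aperiodic (suc k) 1≤k k≤m vₖ≗0 vₖ₊₁≗δ with suc k ℕₚ.≟ m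
  ... | no  k≢m = 1≢0 (begin
    1ℤ                                  ≡⟨ diagonal-refl k ⟨
    pulse (suc k) (suc k)               ≡⟨ f≡pulse (suc k) (suc k) k≤m k<m ⟨
    f (suc k) (suc k)                   ≡⟨ strip-cong (suc e) vₖ≗0 0 (suc k) ⟩
    strip (suc e) (λ _ → 0ℤ) 0 (suc k)  ≡⟨ strip-in (suc e) (λ _ → 0ℤ) 0 k (ℕ.s≤s⁻¹ k<m) ⟩
    0ℤ                                  ∎)
    where
    open ≡-Reasoning
    k<m : suc k < m
    k<m = ℕₚ.≤∧≢⇒< k≤m k≢m
    1≢0 : 1ℤ ≢ 0ℤ
    1≢0 ()
  ... | yes refl = no-return e refl
    where
    open ≡-Reasoning
    fₘ≡0 : ∀ i → f m (suc i) ≡ strip (suc e) (λ _ → 0ℤ) 0 (suc i)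
    fₘ≡0 i = strip-cong (suc e) vₖ≗0 0 (suc i)
    zeros : ∀ i → strip (suc e) (λ _ → 0ℤ) 0 i ≡ 0ℤ
    zeros zero = refl
    zeros (suc i) with i ℕₚ.<? suc e
    ... | yes _ = refl
    ... | no  _ = refl
    return : 1ℤ + diagonal e 0 ≡ 0ℤ
    return = begin
      1ℤ + diagonal e 0          ≡⟨ cong₂ _+_ (strip-in (suc e) δ₀ 0 0 z<s) (f≡pulse (suc e) 1 (ℕₚ.n≤1+n _) (s≤s z<s)) ⟨
      f 1 1 + f (suc e) 1        ≡⟨ cong (_+ f (suc e) 1) (strip-cong (suc e) vₖ₊₁≗δ 0 1) ⟨
      f (suc m) 1 + f (suc e) 1  ≡⟨ strip-cheb e (λ _ → 0ℤ) δ₀ 0 (suc e) 0 (s≤s z<s) ⟩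
      f m 0 + f m 2              ≡⟨ cong (0ℤ +_) (trans (fₘ≡0 1) (zeros 2)) ⟩
      0ℤ                         ∎
    -- `diagonal e 0` is 1 for m = 2 and 0 for larger m, so `return` reads 2 = 0 or 1 = 0.
    no-return : ∀ e′ → e′ ≡ e → ⊥
    no-return zero     refl with () ← return
    no-return (suc e′) refl with () ← return

-- Alternating words

module _ {n : ℕ} where

  length-alt : ∀ (s t : Fin n) k → length (alt s t k) ≡ k
  length-alt s t zero    = refl
  length-alt s t (suc k) = cong suc (length-alt t s k)

  alt-∷ʳ-even : ∀ (s t : Fin n) k → alt s t (suc (k ℕ.* 2)) ≡ alt s t (k ℕ.* 2) ∷ʳ s
  alt-∷ʳ-even s t zero    = refl
  alt-∷ʳ-even s t (suc k) = cong (λ w → s ∷ t ∷ w) (alt-∷ʳ-even s t k)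

  -- Reversal is inversion in W, so this is the passage between the braid relation and (st)^m = 1.
  alt-double : ∀ (s t : Fin n) k → alt s t (k ℕ.* 2) ≡ alt s t k ++ reverse (alt t s k)
  alt-double s t zero    = refl
  alt-double s t (suc k) = cong (s ∷_) (begin
    alt t s (suc (k ℕ.* 2))                    ≡⟨ alt-∷ʳ-even t s k ⟩
    alt t s (k ℕ.* 2) ∷ʳ t                     ≡⟨ cong (_∷ʳ t) (alt-double t s k) ⟩
    (alt t s k ++ reverse (alt s t k)) ∷ʳ t    ≡⟨ ++-assoc (alt t s k) _ _ ⟩
    alt t s k ++ (reverse (alt s t k) ∷ʳ t)    ≡⟨ cong (alt t s k ++_) (unfold-reverse t (alt s t k)) ⟨
    alt t s k ++ reverse (t ∷ alt s t k)       ∎)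
    where open ≡-Reasoning

  alt-+ : ∀ (s t : Fin n) i j → alt s t ((i ℕ.+ j) ℕ.* 2) ≡ alt s t (i ℕ.* 2) ++ alt s t (j ℕ.* 2)
  alt-+ s t zero    j = refl
  alt-+ s t (suc i) j = cong (λ w → s ∷ t ∷ w) (alt-+ s t i j)

  AltEven AltOdd : ℕ → Set
  AltEven k = ∀ (s t : Fin n) → reverse (alt s t k) ≡ alt t s k × alt s t (suc k) ≡ alt s t k ∷ʳ s
  AltOdd  k = ∀ (s t : Fin n) → reverse (alt s t k) ≡ alt s t k × alt s t (suc k) ≡ alt s t k ∷ʳ t

  alt-parity : ∀ k → AltEven k ⊎ AltOdd k
  alt-parity zero = inj₁ (λ s t → refl , refl)
  alt-parity (suc k) with alt-parity k
  ... | inj₁ even = inj₂ (λ s t →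
    trans (unfold-reverse s (alt t s k)) (trans (cong (_∷ʳ s) (proj₁ (even t s))) (sym (proj₂ (even s t)))) ,
    cong (s ∷_) (proj₂ (even t s)))
  ... | inj₂ odd = inj₁ (λ s t →
    trans (unfold-reverse s (alt t s k)) (trans (cong (_∷ʳ s) (proj₁ (odd t s))) (sym (proj₂ (odd t s)))) ,
    cong (s ∷_) (proj₂ (odd t s)))

-- Congruences on words and the action of W

module Artin {n : ℕ} (M : CoxeterMatrix n) where
  open CoxeterMatrix M public
  open Coxeter M public renaming (_≈B_ to infix 4 _≈B_; _≈W_ to infix 4 _≈W_; _≼_ to infix 4 _≼_)

  m′ : Fin n → Fin n → ℕ
  m′ s t = m s t ∸ 1

  m≡1+m′ : ∀ {s t} → s ≢ t → m s t ≡ suc (m′ s t)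
  m≡1+m′ {s} {t} s≢t = sym (ℕₚ.m+[n∸m]≡n {1} (ℕₚ.≤-trans (s≤s z≤n) (off s t s≢t)))

  m′-comm : ∀ s t → m′ s t ≡ m′ t s
  m′-comm s t = cong (_∸ 1) (symm s t)

  alt-m : ∀ {s t} → s ≢ t → alt s t (m s t) ≡ s ∷ alt t s (m′ s t)
  alt-m {s} {t} s≢t = cong (alt s t) (m≡1+m′ s≢t)

  ≡⇒≈W : ∀ {u v} → u ≡ v → u ≈W v
  ≡⇒≈W refl = reflW

  ++-congˡW : ∀ x {u v} → u ≈W v → x ++ u ≈W x ++ v
  ++-congˡW x (braidW u v s t s≢t) = subst₂ _≈W_ (++-assoc x u _) (++-assoc x u _) (braidW (x ++ u) v s t s≢t)
  ++-congˡW x (square u v s)       = subst₂ _≈W_ (++-assoc x u _) (++-assoc x u _) (square (x ++ u) v s)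
  ++-congˡW x reflW                = reflW
  ++-congˡW x (symW p)             = symW (++-congˡW x p)
  ++-congˡW x (transW p q)         = transW (++-congˡW x p) (++-congˡW x q)

  private
    ++-assoc₃ : ∀ (u a v y : Word n) → (u ++ a ++ v) ++ y ≡ u ++ a ++ (v ++ y)
    ++-assoc₃ u a v y = trans (++-assoc u _ y) (cong (u ++_) (++-assoc a v y))

  ++-congʳW : ∀ {u v} y → u ≈W v → u ++ y ≈W v ++ y
  ++-congʳW y (braidW u v s t s≢t) =
    subst₂ _≈W_ (sym (++-assoc₃ u (alt s t (m s t)) v y)) (sym (++-assoc₃ u (alt t s (m s t)) v y)) (braidW u (v ++ y) s t s≢t)
  ++-congʳW y (square u v s)       =
    subst₂ _≈W_ (sym (++-assoc₃ u (s ∷ s ∷ []) v y)) (sym (++-assoc u v y)) (square u (v ++ y) s)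
  ++-congʳW y reflW                = reflW
  ++-congʳW y (symW p)             = symW (++-congʳW y p)
  ++-congʳW y (transW p q)         = transW (++-congʳW y p) (++-congʳW y q)

  ++-inverseʳW : ∀ u v → u ++ reverse u ++ v ≈W v
  ++-inverseʳW []      v = reflW
  ++-inverseʳW (s ∷ u) v =
    transW (≡⇒≈W (cong (λ w → s ∷ u ++ w) (trans (cong (_++ v) (unfold-reverse s u)) (++-assoc (reverse u) [ s ] v))))
      (transW (++-congˡW [ s ] (++-inverseʳW u (s ∷ v))) (square [] v s))

  ++-inverseˡW : ∀ u v → reverse u ++ u ++ v ≈W v
  ++-inverseˡW u v = subst (λ w → reverse u ++ w ++ v ≈W v) (reverse-involutive u) (++-inverseʳW (reverse u) v)

  ++-cancelˡW : ∀ x {u v} → x ++ u ≈W x ++ v → u ≈W v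
  ++-cancelˡW x p = transW (symW (++-inverseˡW x _)) (transW (++-congˡW (reverse x) p) (++-inverseˡW x _))

  reverse-≈W : ∀ {u v} → u ≈W v → reverse u ≈W reverse v
  reverse-≈W {u} {v} p = ++-cancelˡW u (transW (transW (≡⇒≈W (cong (u ++_) (sym (++-identityʳ (reverse u))))) (++-inverseʳW u []))
    (transW (symW (transW (≡⇒≈W (cong (v ++_) (sym (++-identityʳ (reverse v))))) (++-inverseʳW v []))) (++-congʳW (reverse v) (symW p))))

  ≈B⇒≈W : ∀ {u v} → u ≈B v → u ≈W v
  ≈B⇒≈W (braid u v s t s≢t) = braidW u v s t s≢t
  ≈B⇒≈W reflB               = reflW
  ≈B⇒≈W (symB p)            = symW (≈B⇒≈W p)
  ≈B⇒≈W (transB p q)        = transW (≈B⇒≈W p) (≈B⇒≈W q)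

  -- Integral substitute for the contragredient reflection representation
  -- f s ↦ − f s, f r ↦ f r + 2cos(π/m(s,r)) · f s: multiplication by 2cos(π/m) becomes Adj (m ∸ 2).

  e : Fin n → Fin n → ℕ
  e s t = m s t ∸ 2

  m≡2+e : ∀ {s t} → s ≢ t → m s t ≡ 2 ℕ.+ e s t
  m≡2+e {s} {t} s≢t = sym (ℕₚ.m+[n∸m]≡n (off s t s≢t))

  Config : Set
  Config = Fin n → ℕ → ℤ

  infix 4 _≐_
  _≐_ : Config → Config → Set
  f ≐ g = ∀ r → f r ≗ g r

  fire : Fin n → Config → Config
  fire s f r with r ≟ s
  ... | yes _ = λ x → - f s x
  ... | no  _ = λ x → f r x + Adj (e s r) (f s) x

  fire-self : ∀ s f → fire s f s ≗ (λ x → - f s x)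
  fire-self s f x with s ≟ s
  ... | yes _   = refl
  ... | no  s≢s = contradiction refl s≢s

  fire-other : ∀ {s r} f → r ≢ s → fire s f r ≗ (λ x → f r x + Adj (e s r) (f s) x)
  fire-other {s} {r} f r≢s x with r ≟ s
  ... | yes r≡s = contradiction r≡s r≢s
  ... | no  _   = refl

  fire-cong : ∀ s {f g} → f ≐ g → fire s f ≐ fire s g
  fire-cong s f≐g r x with r ≟ s
  ... | yes _ = cong -_ (f≐g s x)
  ... | no  _ = cong₂ _+_ (f≐g r x) (Adj-cong (e s r) (f≐g s) x)

  fire-involutive : ∀ s f → fire s (fire s f) ≐ f
  fire-involutive s f r x with r ≟ s
  ... | yes refl = trans (cong -_ (fire-self s f x)) (ℤₚ.neg-involutive (f s x))
  ... | no  r≢s  = begin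
      fire s f r x + Adj (e s r) (fire s f s) x                     ≡⟨ cong₂ _+_ (fire-other f r≢s x) (Adj-cong (e s r) (fire-self′) x) ⟩
      (f r x + Adj (e s r) (f s) x) + Adj (e s r) (λ x → 0ℤ - f s x) x  ≡⟨ cong ((f r x + Adj (e s r) (f s) x) +_) (Adj-- (e s r) (λ _ → 0ℤ) (f s) x) ⟩
      (f r x + Adj (e s r) (f s) x) + (Adj (e s r) (λ _ → 0ℤ) x - Adj (e s r) (f s) x)  ≡⟨ cong (λ z → (f r x + Adj (e s r) (f s) x) + (z - Adj (e s r) (f s) x)) (Adj-0 (e s r) x) ⟩
      (f r x + Adj (e s r) (f s) x) + (0ℤ - Adj (e s r) (f s) x)    ≡⟨ ring (f r x) (Adj (e s r) (f s) x) ⟩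
      f r x                                                         ∎
    where
    open ≡-Reasoning
    fire-self′ : fire s f s ≗ (λ x → 0ℤ - f s x)
    fire-self′ x = trans (fire-self s f x) (sym (ℤₚ.+-identityˡ (- f s x)))
    ring : ∀ a b → (a + b) + (0ℤ - b) ≡ a
    ring = ℤ-solve

  act : Word n → Config → Config
  act []      f = f
  act (s ∷ w) f = fire s (act w f)

  act-cong : ∀ w {f g} → f ≐ g → act w f ≐ act w g
  act-cong []      f≐g = f≐g
  act-cong (s ∷ w) f≐g = fire-cong s (act-cong w f≐g)

  act-++ : ∀ u v f → act (u ++ v) f ≡ act u (act v f)
  act-++ []      v f = refl
  act-++ (s ∷ u) v f = cong (fire s) (act-++ u v f)

  act-reverse : ∀ w f → act (reverse w) (act w f) ≐ f
  act-reverse []      f r x = refl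
  act-reverse (s ∷ w) f r x = begin
    act (reverse (s ∷ w)) (act (s ∷ w) f) r x                 ≡⟨ cong (λ u → act u (act (s ∷ w) f) r x) (unfold-reverse s w) ⟩
    act (reverse w ++ [ s ]) (act (s ∷ w) f) r x              ≡⟨ cong (λ g → g r x) (act-++ (reverse w) [ s ] (act (s ∷ w) f)) ⟩
    act (reverse w) (fire s (fire s (act w f))) r x           ≡⟨ act-cong (reverse w) (fire-involutive s (act w f)) r x ⟩
    act (reverse w) (act w f) r x                             ≡⟨ act-reverse w f r x ⟩
    f r x                                                     ∎
    where open ≡-Reasoning

  module Dihedral {s t : Fin n} (s≢t : s ≢ t) (f : Config) where

    -- With the sign on `f s`, every single reflection, whether at s or at t, advances the same wave
    -- by one unit of time.
    v : ℕ → ℕ → ℤ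
    v = cheb (e s t) (λ x → - f s x) (f t)

    σ : ℕ → ℕ → ℕ → ℤ
    σ c j x = Σ< j (λ i → v (i ℕ.* 2 ℕ.+ c) x)

    act-alt-t : ∀ j → act (alt s t (j ℕ.* 2)) f t ≗ v (suc (j ℕ.* 2))
    act-alt-s : ∀ j → act (alt s t (j ℕ.* 2)) f s ≗ (λ x → - v (j ℕ.* 2) x)

    fire-t-s : ∀ j → fire t (act (alt s t (j ℕ.* 2)) f) s ≗ v (2 ℕ.+ j ℕ.* 2)
    fire-t-s j x = begin
      fire t g s x                                             ≡⟨ fire-other g s≢t x ⟩
      g s x + Adj (e t s) (g t) x                              ≡⟨ cong₂ _+_ (act-alt-s j x) (trans (cong (λ k → Adj k (g t) x) (cong (_∸ 2) (symm t s))) (Adj-cong (e s t) (act-alt-t j) x)) ⟩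
      - v (j ℕ.* 2) x + Adj (e s t) (v (suc (j ℕ.* 2))) x      ≡⟨ ℤₚ.+-comm (- v (j ℕ.* 2) x) _ ⟩
      v (2 ℕ.+ j ℕ.* 2) x                                      ∎
      where
      open ≡-Reasoning
      g : Config
      g = act (alt s t (j ℕ.* 2)) f

    act-alt-t zero    x = refl
    act-alt-t (suc j) x = begin
      fire s (fire t g) t x                                            ≡⟨ fire-other (fire t g) (≢-sym s≢t) x ⟩
      fire t g t x + Adj (e s t) (fire t g s) x                        ≡⟨ cong₂ _+_ (trans (fire-self t g x) (cong -_ (act-alt-t j x))) (Adj-cong (e s t) (fire-t-s j) x) ⟩
      - v (suc (j ℕ.* 2)) x + Adj (e s t) (v (2 ℕ.+ j ℕ.* 2)) x        ≡⟨ ℤₚ.+-comm (- v (suc (j ℕ.* 2)) x) _ ⟩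
      v (3 ℕ.+ j ℕ.* 2) x                                              ∎
      where
      open ≡-Reasoning
      g : Config
      g = act (alt s t (j ℕ.* 2)) f
    act-alt-s zero    x = sym (ℤₚ.neg-involutive (f s x))
    act-alt-s (suc j) x = trans (fire-self s (fire t (act (alt s t (j ℕ.* 2)) f)) x) (cong -_ (fire-t-s j x))

    -- The coordinates s and t evolve without reading r, and r merely accumulates images of their
    -- successive values. This is why the contragredient form is used: no two operators `Adj`, which
    -- need not commute, ever have to be interchanged.
    act-alt-other : ∀ {r} → r ≢ s → r ≢ t → ∀ j →
      act (alt s t (j ℕ.* 2)) f r ≗ (λ x → f r x + (Adj (e t r) (σ 1 j) x + Adj (e s r) (σ 2 j) x))
    act-alt-other {r} r≢s r≢t zero x = begin
      f r x                                                      ≡⟨ ℤₚ.+-identityʳ (f r x) ⟨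
      f r x + (0ℤ + 0ℤ)                                          ≡⟨ cong (f r x +_) (cong₂ _+_ (Adj-0 (e t r) x) (Adj-0 (e s r) x)) ⟨
      f r x + (Adj (e t r) (λ _ → 0ℤ) x + Adj (e s r) (λ _ → 0ℤ) x)  ∎
      where open ≡-Reasoning
    act-alt-other {r} r≢s r≢t (suc j) x = begin
      fire s (fire t g) r x
        ≡⟨ fire-other (fire t g) r≢s x ⟩
      fire t g r x + Adj (e s r) (fire t g s) x
        ≡⟨ cong₂ _+_ (trans (fire-other g r≢t x) (cong₂ _+_ (act-alt-other r≢s r≢t j x) (Adj-cong (e t r) (λ y → trans (act-alt-t j y) (cong (λ k → v k y) (ℕₚ.+-comm 1 (j ℕ.* 2)))) x)))
                     (Adj-cong (e s r) (λ y → trans (fire-t-s j y) (cong (λ k → v k y) (ℕₚ.+-comm 2 (j ℕ.* 2)))) x) ⟩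
      ((f r x + (A₁ + A₂)) + B₁) + B₂
        ≡⟨ ring (f r x) A₁ A₂ B₁ B₂ ⟩
      f r x + ((A₁ + B₁) + (A₂ + B₂))
        ≡⟨ cong (f r x +_) (cong₂ _+_ (Adj-+ (e t r) (σ 1 j) (v (j ℕ.* 2 ℕ.+ 1)) x) (Adj-+ (e s r) (σ 2 j) (v (j ℕ.* 2 ℕ.+ 2)) x)) ⟨
      f r x + (Adj (e t r) (σ 1 (suc j)) x + Adj (e s r) (σ 2 (suc j)) x) ∎
      where
      open ≡-Reasoning
      g : Config
      g = act (alt s t (j ℕ.* 2)) f
      A₁ A₂ B₁ B₂ : ℤ
      A₁ = Adj (e t r) (σ 1 j) x
      A₂ = Adj (e s r) (σ 2 j) x
      B₁ = Adj (e t r) (v (j ℕ.* 2 ℕ.+ 1)) x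
      B₂ = Adj (e s r) (v (j ℕ.* 2 ℕ.+ 2)) x
      ring : ∀ a b c d f → ((a + (b + c)) + d) + f ≡ a + ((b + d) + (c + f))
      ring = ℤ-solve

    private
      v-period : ∀ k → v (m s t ℕ.* 2 ℕ.+ k) ≗ v k
      v-period k x = trans (cong (λ i → v (i ℕ.* 2 ℕ.+ k) x) (m≡2+e s≢t)) (cheb-periodic (e s t) _ _ k x)

      σ-zero : ∀ c → σ c (m s t) ≗ (λ _ → 0ℤ)
      σ-zero c x = trans (cong (λ i → σ c i x) (m≡2+e s≢t)) (cheb-sum (e s t) _ _ c x)

    act-alt-m : act (alt s t (m s t ℕ.* 2)) f ≐ f
    act-alt-m r x with r ≟ s | r ≟ t
    ... | yes refl | _        = trans (act-alt-s (m s t) x) (trans (cong -_ (trans (cong (λ k → v k x) (sym (ℕₚ.+-identityʳ (m s t ℕ.* 2)))) (v-period 0 x))) (ℤₚ.neg-involutive (f s x)))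
    ... | no  _    | yes refl = trans (act-alt-t (m s t) x) (trans (cong (λ k → v k x) (ℕₚ.+-comm 1 (m s t ℕ.* 2))) (v-period 1 x))
    ... | no  r≢s  | no  r≢t  = begin
        act (alt s t (m s t ℕ.* 2)) f r x                                          ≡⟨ act-alt-other r≢s r≢t (m s t) x ⟩
        f r x + (Adj (e t r) (σ 1 (m s t)) x + Adj (e s r) (σ 2 (m s t)) x)        ≡⟨ cong (f r x +_) (cong₂ _+_ (vanish (e t r) 1) (vanish (e s r) 2)) ⟩
        f r x + (0ℤ + 0ℤ)                                                          ≡⟨ ℤₚ.+-identityʳ (f r x) ⟩
        f r x                                                                      ∎
      where
      open ≡-Reasoning
      vanish : ∀ k c → Adj k (σ c (m s t)) x ≡ 0ℤ
      vanish k c = trans (Adj-cong k (σ-zero c) x) (Adj-0 k x)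

  act-braid : ∀ {s t} → s ≢ t → ∀ f → act (alt s t (m s t)) f ≐ act (alt t s (m s t)) f
  act-braid {s} {t} s≢t f r x = begin
    act a f r x                           ≡⟨ act-cong a (act-reverse b f) r x ⟨
    act a (act (reverse b) (act b f)) r x ≡⟨ cong (λ g → g r x) (act-++ a (reverse b) (act b f)) ⟨
    act (a ++ reverse b) (act b f) r x    ≡⟨ cong (λ w → act w (act b f) r x) (alt-double s t (m s t)) ⟨
    act (alt s t (m s t ℕ.* 2)) (act b f) r x ≡⟨ Dihedral.act-alt-m s≢t (act b f) r x ⟩
    act b f r x                           ∎
    where
    open ≡-Reasoning
    a b : Word n
    a = alt s t (m s t)
    b = alt t s (m s t)

  act-≈W : ∀ {u v} → u ≈W v → ∀ f → act u f ≐ act v f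
  act-≈W (braidW u v s t s≢t) f r x = begin
    act (u ++ alt s t (m s t) ++ v) f r x         ≡⟨ cong (λ g → g r x) (trans (act-++ u _ f) (cong (act u) (act-++ (alt s t (m s t)) v f))) ⟩
    act u (act (alt s t (m s t)) (act v f)) r x   ≡⟨ act-cong u (act-braid s≢t (act v f)) r x ⟩
    act u (act (alt t s (m s t)) (act v f)) r x   ≡⟨ cong (λ g → g r x) (trans (act-++ u _ f) (cong (act u) (act-++ (alt t s (m s t)) v f))) ⟨
    act (u ++ alt t s (m s t) ++ v) f r x         ∎
    where open ≡-Reasoning
  act-≈W (square u v s) f r x = begin
    act (u ++ s ∷ s ∷ v) f r x            ≡⟨ cong (λ g → g r x) (act-++ u _ f) ⟩
    act u (fire s (fire s (act v f))) r x ≡⟨ act-cong u (fire-involutive s (act v f)) r x ⟩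
    act u (act v f) r x                   ≡⟨ cong (λ g → g r x) (act-++ u v f) ⟨
    act (u ++ v) f r x                    ∎
    where open ≡-Reasoning
  act-≈W reflW        f r x = refl
  act-≈W (symW p)     f r x = sym (act-≈W p f r x)
  act-≈W (transW p q) f r x = trans (act-≈W p f r x) (act-≈W q f r x)

  alt-double-m : ∀ {s t} → s ≢ t → alt s t (m s t ℕ.* 2) ≈W []
  alt-double-m {s} {t} s≢t =
    transW (≡⇒≈W (alt-double s t (m s t)))
      (transW (≡⇒≈W (cong (alt s t (m s t) ++_) (sym (++-identityʳ _))))
        (transW (braidW [] _ s t s≢t) (++-inverseʳW (alt t s (m s t)) [])))

  private
    -- The configuration with `δ₀` at t and zero elsewhere releases the pulse. If (st)^i fixed it,
    -- the initial state would recur at time 2i ≤ m, when the pulse has at most just met the far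
    -- wall.
    alt-not-identity-half : ∀ {s t} → s ≢ t → ∀ i → 1 ≤ i → i ℕ.* 2 ≤ m s t → ¬ (alt s t (i ℕ.* 2) ≈W [])
    alt-not-identity-half {s} {t} s≢t i 1≤i 2i≤m p =
      Pulse.cheb-aperiodic (e s t) (i ℕ.* 2) (ℕₚ.≤-trans 1≤i (ℕₚ.m≤m*n i 2)) (subst (i ℕ.* 2 ≤_) (m≡2+e s≢t) 2i≤m)
        (λ x → trans (cheb-zero (i ℕ.* 2) x) (ℤₚ.neg-injective (trans (sym (act-alt-s i x)) (trans (act-≈W p f s x) (f-s x)))))
        (λ x → trans (cheb-zero (suc (i ℕ.* 2)) x) (trans (sym (act-alt-t i x)) (trans (act-≈W p f t x) (f-t x))))
      where
      f : Config
      f r with r ≟ t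
      ... | yes _ = δ₀
      ... | no  _ = λ _ → 0ℤ
      f-t : f t ≗ δ₀
      f-t x with t ≟ t
      ... | yes _   = refl
      ... | no  t≢t = contradiction refl t≢t
      f-s : f s ≗ (λ _ → 0ℤ)
      f-s x with s ≟ t
      ... | yes s≡t = contradiction s≡t s≢t
      ... | no  _   = refl
      open Dihedral s≢t f
      cheb-zero : ∀ k → cheb (e s t) (λ _ → 0ℤ) δ₀ k ≗ v k
      cheb-zero zero          x = cong -_ (sym (f-s x))
      cheb-zero (suc zero)    x = sym (f-t x)
      cheb-zero (suc (suc k)) x = cong₂ _-_ (Adj-cong (e s t) (cheb-zero (suc k)) x) (cheb-zero k x)

  alt-not-identity : ∀ {s t} → s ≢ t → ∀ i → 1 ≤ i → i < m s t → ¬ (alt s t (i ℕ.* 2) ≈W [])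
  alt-not-identity {s} {t} s≢t i 1≤i i<m p with (i ℕ.* 2) ℕₚ.≤? m s t
  ... | yes 2i≤m = alt-not-identity-half s≢t i 1≤i 2i≤m p
  -- As (st)^m is trivial, (st)^i and (st)^(m - i) are trivial together, and the smaller of the two
  -- exponents is at most m/2.
  ... | no  2i≰m = alt-not-identity-half s≢t j (ℕₚ.m<n⇒0<n∸m i<m) 2j≤m q
    where
    j : ℕ
    j = m s t ∸ i
    i+j≡m : i ℕ.+ j ≡ m s t
    i+j≡m = ℕₚ.m+[n∸m]≡n (ℕₚ.<⇒≤ i<m)
    2j≤m : j ℕ.* 2 ≤ m s t
    2j≤m = ℕₚ.+-cancelˡ-≤ (i ℕ.* 2) _ _ (ℕₚ.≤-trans (ℕₚ.≤-reflexive (trans (sym (ℕₚ.*-distribʳ-+ 2 i j)) (trans (cong (ℕ._* 2) i+j≡m) (double (m s t)))))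
                                      (ℕₚ.+-monoˡ-≤ (m s t) (ℕₚ.<⇒≤ (ℕₚ.≰⇒> 2i≰m))))
      where
      double : ∀ k → k ℕ.* 2 ≡ k ℕ.+ k
      double = ℕ-solve
    q : alt s t (j ℕ.* 2) ≈W []
    q = transW (symW (++-congʳW _ p)) (transW (≡⇒≈W (sym (alt-+ s t i j))) (transW (≡⇒≈W (cong (λ k → alt s t (k ℕ.* 2)) i+j≡m)) (alt-double-m s≢t)))

  -- The braid monoid: length, reversal and reducts

  ++-congˡB : ∀ x {u v} → u ≈B v → x ++ u ≈B x ++ v
  ++-congˡB x (braid u v s t s≢t) = subst₂ _≈B_ (++-assoc x u _) (++-assoc x u _) (braid (x ++ u) v s t s≢t)
  ++-congˡB x reflB               = reflB
  ++-congˡB x (symB p)            = symB (++-congˡB x p)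
  ++-congˡB x (transB p q)        = transB (++-congˡB x p) (++-congˡB x q)

  ++-congʳB : ∀ {u v} y → u ≈B v → u ++ y ≈B v ++ y
  ++-congʳB y (braid u v s t s≢t) =
    subst₂ _≈B_ (sym (++-assoc₃ u (alt s t (m s t)) v y)) (sym (++-assoc₃ u (alt t s (m s t)) v y)) (braid u (v ++ y) s t s≢t)
  ++-congʳB y reflB               = reflB
  ++-congʳB y (symB p)            = symB (++-congʳB y p)
  ++-congʳB y (transB p q)        = transB (++-congʳB y p) (++-congʳB y q)

  ≡⇒≈B : ∀ {u v} → u ≡ v → u ≈B v
  ≡⇒≈B refl = reflB

  length-≈B : ∀ {u v} → u ≈B v → length u ≡ length v
  length-≈B (braid u v s t s≢t) = begin
    length (u ++ alt s t (m s t) ++ v)                   ≡⟨ length-++₃ (alt s t (m s t)) ⟩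
    length u ℕ.+ (length (alt s t (m s t)) ℕ.+ length v) ≡⟨ cong (λ k → length u ℕ.+ (k ℕ.+ length v)) (trans (length-alt s t (m s t)) (sym (length-alt t s (m s t)))) ⟩
    length u ℕ.+ (length (alt t s (m s t)) ℕ.+ length v) ≡⟨ length-++₃ (alt t s (m s t)) ⟨
    length (u ++ alt t s (m s t) ++ v)                   ∎
    where
    open ≡-Reasoning
    length-++₃ : ∀ a → length (u ++ a ++ v) ≡ length u ℕ.+ (length a ℕ.+ length v)
    length-++₃ a = trans (length-++ u) (cong (length u ℕ.+_) (length-++ a))
  length-≈B reflB        = refl
  length-≈B (symB p)     = sym (length-≈B p)
  length-≈B (transB p q) = trans (length-≈B p) (length-≈B q)

  braid-alt : ∀ {s t} → s ≢ t → ∀ w → s ∷ alt t s (m′ s t) ++ w ≈B t ∷ alt s t (m′ s t) ++ w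
  braid-alt {s} {t} s≢t w = subst (λ k → alt s t k ++ w ≈B alt t s k ++ w) (m≡1+m′ s≢t) (braid [] w s t s≢t)

  -- s ∷ u and t ∷ v are equal for the obvious reason: they are the same multiple of lcm(s, t).
  Reduct : Fin n → Word n → Fin n → Word n → Set
  Reduct s u t v = (s ≡ t × u ≈B v) ⊎
    (s ≢ t × ∃ λ w → u ≈B alt t s (m′ s t) ++ w × v ≈B alt s t (m′ s t) ++ w)

  Reduct-sym : ∀ {s u t v} → Reduct s u t v → Reduct t v s u
  Reduct-sym (inj₁ (refl , p)) = inj₁ (refl , symB p)
  Reduct-sym {s} {_} {t} (inj₂ (s≢t , w , p , q)) rewrite m′-comm s t = inj₂ (≢-sym s≢t , w , q , p)

  Reduct-resp : ∀ {s u t v u′ v′} → u′ ≈B u → v ≈B v′ → Reduct s u t v → Reduct s u′ t v′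
  Reduct-resp p q (inj₁ (s≡t , r)) = inj₁ (s≡t , transB p (transB r q))
  Reduct-resp p q (inj₂ (s≢t , w , r₁ , r₂)) = inj₂ (s≢t , w , transB p r₁ , transB (symB q) r₂)

  reverse-≈B : ∀ {u v} → u ≈B v → reverse u ≈B reverse v
  reverse-≈B (braid u v s t s≢t) = subst₂ _≈B_ (sym (reverse-++₃ (alt s t (m s t)))) (sym (reverse-++₃ (alt t s (m s t)))) reversed
    where
    reverse-++₃ : ∀ a → reverse (u ++ a ++ v) ≡ reverse v ++ reverse a ++ reverse u
    reverse-++₃ a = trans (reverse-++ u (a ++ v)) (trans (cong (_++ reverse u) (reverse-++ a v)) (++-assoc (reverse v) (reverse a) (reverse u)))
    reversed : reverse v ++ reverse (alt s t (m s t)) ++ reverse u ≈B reverse v ++ reverse (alt t s (m s t)) ++ reverse u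
    reversed with alt-parity (m s t)
    ... | inj₁ even rewrite proj₁ (even s t) | proj₁ (even t s) = symB (braid (reverse v) (reverse u) s t s≢t)
    ... | inj₂ odd  rewrite proj₁ (odd s t)  | proj₁ (odd t s)  = braid (reverse v) (reverse u) s t s≢t
  reverse-≈B reflB        = reflB
  reverse-≈B (symB p)     = symB (reverse-≈B p)
  reverse-≈B (transB p q) = transB (reverse-≈B p) (reverse-≈B q)

-- Reflections and the exchange condition

xor< : ℕ → (ℕ → Bool) → Bool
xor< zero    g = false
xor< (suc k) g = g 0 xor xor< k (λ i → g (suc i))

xor<-cong : ∀ k {g h} → (∀ i → i < k → g i ≡ h i) → xor< k g ≡ xor< k h
xor<-cong zero    eq = refl
xor<-cong (suc k) eq = cong₂ _xor_ (eq 0 z<s) (xor<-cong k (λ i i<k → eq (suc i) (s<s i<k)))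

xor<-last : ∀ k g → xor< (suc k) g ≡ g k xor xor< k g
xor<-last zero    g = refl
xor<-last (suc k) g = begin
  g 0 xor xor< (suc k) (λ i → g (suc i))               ≡⟨ cong (g 0 xor_) (xor<-last k (λ i → g (suc i))) ⟩
  g 0 xor (g (suc k) xor xor< k (λ i → g (suc i)))     ≡⟨ xor-assoc (g 0) (g (suc k)) _ ⟨
  (g 0 xor g (suc k)) xor xor< k (λ i → g (suc i))     ≡⟨ cong (_xor xor< k (λ i → g (suc i))) (xor-comm (g 0) (g (suc k))) ⟩
  (g (suc k) xor g 0) xor xor< k (λ i → g (suc i))     ≡⟨ xor-assoc (g (suc k)) (g 0) _ ⟩
  g (suc k) xor (g 0 xor xor< k (λ i → g (suc i)))     ∎
  where open ≡-Reasoning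

xor<-reverse : ∀ k g → xor< k (λ i → g (k ∸ suc i)) ≡ xor< k g
xor<-reverse zero    g = refl
xor<-reverse (suc k) g = trans (cong (g k xor_) (xor<-reverse k g)) (sym (xor<-last k g))

xor<-false : ∀ k {g} → (∀ i → i < k → g i ≡ false) → xor< k g ≡ false
xor<-false zero    eq = refl
xor<-false (suc k) eq = cong₂ _xor_ (eq 0 z<s) (xor<-false k (λ i i<k → eq (suc i) (s<s i<k)))

module _ {n : ℕ} where

  alt-conj : ∀ (s t : Fin n) k → alt s t (suc (suc k ℕ.* 2)) ≡ s ∷ alt t s (suc (k ℕ.* 2)) ∷ʳ s
  alt-conj s t k = cong (λ w → s ∷ t ∷ w) (alt-∷ʳ-even s t k)

  alt-palindrome : ∀ (s t : Fin n) k → reverse (alt s t (suc (k ℕ.* 2))) ≡ alt s t (suc (k ℕ.* 2))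
  alt-palindrome s t zero    = refl
  alt-palindrome s t (suc k) = begin
    reverse (alt s t (suc (suc k ℕ.* 2)))               ≡⟨ cong reverse (alt-conj s t k) ⟩
    reverse (s ∷ alt t s (suc (k ℕ.* 2)) ∷ʳ s)          ≡⟨ unfold-reverse s (alt t s (suc (k ℕ.* 2)) ∷ʳ s) ⟩
    reverse (alt t s (suc (k ℕ.* 2)) ∷ʳ s) ∷ʳ s         ≡⟨ cong (_∷ʳ s) (reverse-++ (alt t s (suc (k ℕ.* 2))) [ s ]) ⟩
    s ∷ reverse (alt t s (suc (k ℕ.* 2))) ∷ʳ s          ≡⟨ cong (λ w → s ∷ w ∷ʳ s) (alt-palindrome t s k) ⟩
    s ∷ alt t s (suc (k ℕ.* 2)) ∷ʳ s                    ≡⟨ alt-conj s t k ⟨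
    alt s t (suc (suc k ℕ.* 2))                         ∎
    where open ≡-Reasoning

module Reflections {n : ℕ} (M : CoxeterMatrix n)
  (_≈W?_ : ∀ u v → Dec (Coxeter._≈W_ M u v)) where
  open Artin M

  -- Parity of the number of occurrences of the reflection x among the
  -- reflections s₁⋯sᵢ₋₁ sᵢ sᵢ₋₁⋯s₁ attached to the word s₁⋯sₖ.
  N : Word n → Word n → Bool
  N []      x = false
  N (s ∷ u) x = does (x ≈W? [ s ]) xor N u (s ∷ x ∷ʳ s)

  -- Represents u⁻¹ x u; it follows the recursion of `N`, which makes `N-++` a plain induction.
  conj : Word n → Word n → Word n
  conj []      x = x
  conj (s ∷ u) x = conj u (s ∷ x ∷ʳ s)

  sxs-cong : ∀ s {x y} → x ≈W y → s ∷ x ∷ʳ s ≈W s ∷ y ∷ʳ s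
  sxs-cong s p = ++-congˡW [ s ] (++-congʳW [ s ] p)

  sxs-involutive : ∀ s x → s ∷ (s ∷ x ∷ʳ s) ∷ʳ s ≈W x
  sxs-involutive s x = transW (square [] _ s)
    (transW (≡⇒≈W (++-assoc x [ s ] [ s ])) (transW (square x [] s) (≡⇒≈W (++-identityʳ x))))

  sxs≈y⇒x≈sys : ∀ s {x y} → s ∷ x ∷ʳ s ≈W y → x ≈W s ∷ y ∷ʳ s
  sxs≈y⇒x≈sys s p = transW (symW (sxs-involutive s _)) (sxs-cong s p)

  x≈sys⇒sxs≈y : ∀ s {x y} → x ≈W s ∷ y ∷ʳ s → s ∷ x ∷ʳ s ≈W y
  x≈sys⇒sxs≈y s p = transW (sxs-cong s p) (sxs-involutive s _)

  ++-conj : ∀ u x → u ++ conj u x ≈W x ++ u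
  ++-conj []      x = ≡⇒≈W (sym (++-identityʳ x))
  ++-conj (s ∷ u) x = transW (++-congˡW [ s ] (++-conj u (s ∷ x ∷ʳ s)))
    (transW (square [] _ s) (≡⇒≈W (++-assoc x [ s ] u)))

  conj-cong : ∀ {u v x y} → u ≈W v → x ≈W y → conj u x ≈W conj v y
  conj-cong {u} {v} {x} {y} p q = ++-cancelˡW u
    (transW (++-conj u x) (transW (++-congʳW u q) (transW (++-congˡW y p)
      (transW (symW (++-conj v y)) (++-congʳW (conj v y) (symW p))))))

  does-cong : ∀ {x y u v} → (x ≈W y → u ≈W v) → (u ≈W v → x ≈W y) → does (x ≈W? y) ≡ does (u ≈W? v)
  does-cong f g = does-⇔ (mk⇔ f g) (_ ≈W? _) (_ ≈W? _)

  N-cong : ∀ u {x y} → x ≈W y → N u x ≡ N u y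
  N-cong []      p = refl
  N-cong (s ∷ u) p = cong₂ _xor_ (does-cong (transW (symW p)) (transW p)) (N-cong u (sxs-cong s p))

  N-++ : ∀ u v x → N (u ++ v) x ≡ N u x xor N v (conj u x)
  N-++ []      v x = refl
  N-++ (s ∷ u) v x = trans (cong (does (x ≈W? [ s ]) xor_) (N-++ u v (s ∷ x ∷ʳ s)))
    (sym (xor-assoc (does (x ≈W? [ s ])) (N u (s ∷ x ∷ʳ s)) _))

  N-alt : ∀ s t k x → N (alt s t k) x ≡ xor< k (λ i → does (x ≈W? alt s t (suc (i ℕ.* 2))))
  N-alt s t zero    x = refl
  N-alt s t (suc k) x = cong (does (x ≈W? [ s ]) xor_) (trans (N-alt t s k (s ∷ x ∷ʳ s))
    (xor<-cong k (λ i _ → does-cong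
      (λ p → transW (sxs≈y⇒x≈sys s p) (≡⇒≈W (sym (alt-conj s t i))))
      (λ p → x≈sys⇒sxs≈y s (transW p (≡⇒≈W (alt-conj s t i)))))))

  -- Both sides are palindromes, hence involutions, and their product is (st)^m. Thus the two sides
  -- of a braid relation carry the same m reflections in opposite order, which gives `N-braid`.
  alt-opposite : ∀ {s t} → s ≢ t → ∀ i → i < m s t → alt t s (suc (i ℕ.* 2)) ≈W alt s t (suc ((m s t ∸ suc i) ℕ.* 2))
  alt-opposite {s} {t} s≢t i i<m =
    transW (symW (++-inverseˡW r (alt t s (suc (i ℕ.* 2)))))
      (transW (++-congˡW (reverse r) product≈[])
        (≡⇒≈W (trans (++-identityʳ (reverse r)) (alt-palindrome s t j))))
    where
    j : ℕ
    j = m s t ∸ suc i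
    r : Word n
    r = alt s t (suc (j ℕ.* 2))
    j+1+i≡m : j ℕ.+ suc i ≡ m s t
    j+1+i≡m = ℕₚ.m∸n+n≡m i<m
    product≈[] : r ++ alt t s (suc (i ℕ.* 2)) ≈W []
    product≈[] = transW (≡⇒≈W (begin
        r ++ alt t s (suc (i ℕ.* 2))                            ≡⟨ cong (_++ alt t s (suc (i ℕ.* 2))) (alt-∷ʳ-even s t j) ⟩
        (alt s t (j ℕ.* 2) ∷ʳ s) ++ alt t s (suc (i ℕ.* 2))     ≡⟨ ++-assoc (alt s t (j ℕ.* 2)) [ s ] _ ⟩
        alt s t (j ℕ.* 2) ++ alt s t (suc i ℕ.* 2)              ≡⟨ alt-+ s t j (suc i) ⟨
        alt s t ((j ℕ.+ suc i) ℕ.* 2)                           ≡⟨ cong (λ k → alt s t (k ℕ.* 2)) j+1+i≡m ⟩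
        alt s t (m s t ℕ.* 2)                                   ∎)) (alt-double-m s≢t)
      where open ≡-Reasoning

  N-braid : ∀ {s t} → s ≢ t → ∀ x → N (alt s t (m s t)) x ≡ N (alt t s (m s t)) x
  N-braid {s} {t} s≢t x = begin
    N (alt s t (m s t)) x                                                         ≡⟨ N-alt s t (m s t) x ⟩
    xor< (m s t) (λ i → does (x ≈W? alt s t (suc (i ℕ.* 2))))                     ≡⟨ xor<-reverse (m s t) (λ i → does (x ≈W? alt s t (suc (i ℕ.* 2)))) ⟨
    xor< (m s t) (λ i → does (x ≈W? alt s t (suc ((m s t ∸ suc i) ℕ.* 2))))       ≡⟨ xor<-cong (m s t) (λ i i<m → does-cong (λ p → transW p (symW (alt-opposite s≢t i i<m))) (λ p → transW p (alt-opposite s≢t i i<m))) ⟩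
    xor< (m s t) (λ i → does (x ≈W? alt t s (suc (i ℕ.* 2))))                     ≡⟨ N-alt t s (m s t) x ⟨
    N (alt t s (m s t)) x                                                         ∎
    where open ≡-Reasoning

  N-≈W : ∀ {u v} → u ≈W v → ∀ x → N u x ≡ N v x
  N-≈W (braidW u v s t s≢t) x = begin
    N (u ++ a ++ v) x                                        ≡⟨ N-++₃ a ⟩
    N u x xor (N a (conj u x) xor N v (conj a (conj u x)))   ≡⟨ cong (N u x xor_) (cong₂ _xor_ (N-braid s≢t (conj u x)) (N-cong v (conj-cong a≈b reflW))) ⟩
    N u x xor (N b (conj u x) xor N v (conj b (conj u x)))   ≡⟨ N-++₃ b ⟨
    N (u ++ b ++ v) x                                        ∎
    where
    open ≡-Reasoning
    a b : Word n
    a = alt s t (m s t)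
    b = alt t s (m s t)
    a≈b : a ≈W b
    a≈b = subst₂ _≈W_ (++-identityʳ a) (++-identityʳ b) (braidW [] [] s t s≢t)
    N-++₃ : ∀ a → N (u ++ a ++ v) x ≡ N u x xor (N a (conj u x) xor N v (conj a (conj u x)))
    N-++₃ a = trans (N-++ u (a ++ v) x) (cong (N u x xor_) (N-++ a v (conj u x)))
  N-≈W (square u v s) x = begin
    N (u ++ s ∷ s ∷ v) x           ≡⟨ N-++ u (s ∷ s ∷ v) x ⟩
    N u x xor N (s ∷ s ∷ v) y      ≡⟨ cong (N u x xor_) (xor-assoc (does (y ≈W? [ s ])) _ _) ⟨
    N u x xor ((does (y ≈W? [ s ]) xor does ((s ∷ y ∷ʳ s) ≈W? [ s ])) xor N v (s ∷ (s ∷ y ∷ʳ s) ∷ʳ s))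
      ≡⟨ cong (N u x xor_) (cong₂ _xor_ (trans (cong (_xor does ((s ∷ y ∷ʳ s) ≈W? [ s ])) same) (xor-same (does ((s ∷ y ∷ʳ s) ≈W? [ s ])))) (N-cong v (sxs-involutive s y))) ⟩
    N u x xor N v y                ≡⟨ N-++ u v x ⟨
    N (u ++ v) x                   ∎
    where
    open ≡-Reasoning
    y : Word n
    y = conj u x
    same : does (y ≈W? [ s ]) ≡ does ((s ∷ y ∷ʳ s) ≈W? [ s ])
    same = does-cong (λ p → x≈sys⇒sxs≈y s (transW p (symW (square [] [ s ] s))))
                     (λ p → transW (sxs≈y⇒x≈sys s p) (square [] [ s ] s))
  N-≈W reflW        x = refl
  N-≈W (symW p)     x = sym (N-≈W p x)
  N-≈W (transW p q) x = trans (N-≈W p x) (N-≈W q x)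

  -- An odd count is not zero, so `x` is the reflection attached to some letter; multiplying by `x`
  -- deletes the first such letter.
  strong-exchange : ∀ u x → N u x ≡ true → ∃ λ y → suc (length y) ≡ length u × x ++ u ≈W y
  strong-exchange (s ∷ u) x eq with x ≈W? [ s ]
  ... | yes x≈s = u , refl , transW (++-congʳW (s ∷ u) x≈s) (square [] u s)
  ... | no  _   with strong-exchange u (s ∷ x ∷ʳ s) eq
  ...   | y , len , p = s ∷ y , cong suc len ,
    transW (symW (square [] _ s)) (++-congˡW [ s ] (transW (≡⇒≈W (cong (s ∷_) (sym (++-assoc x [ s ] u)))) p))

  N-head : ∀ s u → N (s ∷ u) [ s ] ≡ not (N u [ s ])
  N-head s u = cong₂ _xor_ (dec-true ([ s ] ≈W? [ s ]) reflW) (N-cong u (square [] [ s ] s))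

-- Reduced words and the longest element

module ReducedWords {n : ℕ} (M : CoxeterMatrix n)
  (_≈W?_ : ∀ u v → Dec (Coxeter._≈W_ M u v)) where
  open Artin M
  open Reflections M _≈W?_

  reduced-resp : ∀ {u v} → IsReduced u → v ≈W u → length v ≡ length u → IsReduced v
  reduced-resp red v≈u len w w≈v = subst (_≤ length w) (sym len) (red w (transW w≈v v≈u))

  reduced-++ʳ : ∀ u {v} → IsReduced (u ++ v) → IsReduced v
  reduced-++ʳ u {v} red w w≈v = ℕₚ.+-cancelˡ-≤ (length u) _ _
    (subst₂ _≤_ (length-++ u) (length-++ u) (red (u ++ w) (++-congˡW u w≈v)))

  reduced-++ˡ : ∀ u {v} → IsReduced (u ++ v) → IsReduced u
  reduced-++ˡ u {v} red w w≈u = ℕₚ.+-cancelʳ-≤ (length v) _ _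
    (subst₂ _≤_ (length-++ u) (length-++ w) (red (w ++ v) (++-congʳW v w≈u)))

  reduced-length : ∀ {u v} → IsReduced u → IsReduced v → u ≈W v → length u ≡ length v
  reduced-length red-u red-v u≈v = ℕₚ.≤-antisym (red-u _ (symW u≈v)) (red-v _ u≈v)

  shift-left : ∀ {s u y} → s ∷ u ≈W y → u ≈W s ∷ y
  shift-left {s} {u} p = transW (symW (square [] u s)) (++-congˡW [ s ] p)

  descent-head : ∀ {t v} → IsReduced (t ∷ v) → N (t ∷ v) [ t ] ≡ true
  descent-head {t} {v} red = trans (N-head t v) (no-descent (N v [ t ]) refl)
    where
    no-descent : ∀ b → N v [ t ] ≡ b → not b ≡ true
    no-descent false _  = refl
    no-descent true  eq with strong-exchange v [ t ] eq
    ... | y , len , p = contradiction (red y (symW p)) (ℕₚ.<⇒≱ (ℕₚ.≤-trans (ℕₚ.≤-reflexive len) (ℕₚ.n≤1+n _)))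

  descent : ∀ {u t v} → IsReduced u → u ≈W t ∷ v → length u ≡ suc (length v) → N u [ t ] ≡ true
  descent {u} {t} red p len = trans (N-≈W p [ t ]) (descent-head (reduced-resp red (symW p) (sym len)))

  -- Left multiplication by s flips the parity at s. So exchange deletes a letter from any word for
  -- s u and leaves a word for u, which is no shorter than `u`.
  ascent : ∀ {u s} → IsReduced u → N u [ s ] ≡ false → IsReduced (s ∷ u)
  ascent {u} {s} red eq v v≈su with strong-exchange v [ s ] (trans (N-≈W v≈su [ s ]) (trans (N-head s u) (cong not eq)))
  ... | y , len , p = subst (suc (length u) ≤_) len (s≤s (red y (transW (symW p) (symW (shift-left (symW v≈su))))))

  reduce : ∀ w → ∃ λ v → IsReduced v × v ≈W w
  reduce [] = [] , (λ _ _ → z≤n) , reflW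
  reduce (s ∷ w) with reduce w
  ... | v , red , v≈w with N v [ s ] in eq
  ...   | false = s ∷ v , ascent red eq , ++-congˡW [ s ] v≈w
  ...   | true with strong-exchange v [ s ] eq
  ...     | y , len , p = y , shorter , transW (symW p) (++-congˡW [ s ] v≈w)
    where
    shorter : IsReduced y
    shorter z z≈y = ℕ.s≤s⁻¹ (subst (_≤ suc (length z)) (sym len)
      (red (s ∷ z) (transW (++-congˡW [ s ] z≈y) (symW (shift-left p)))))

  -- The reflections of alt t s k are distinct from s as long as k < m(s,t); so the letter that the exchange
  -- condition removes lies in y.
  dihedral-prefix : ∀ k {s t} u → s ≢ t → N u [ s ] ≡ true → N u [ t ] ≡ true → k ≤ m s t →
                    ∃ λ y → alt s t k ++ y ≈W u × k ℕ.+ length y ≡ length u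
  dihedral-prefix zero    u s≢t Ns Nt k≤m = u , reflW , refl
  dihedral-prefix (suc k) {s} {t} u s≢t Ns Nt k<m
    with dihedral-prefix k u (≢-sym s≢t) Nt Ns (subst (k ≤_) (symm s t) (ℕₚ.<⇒≤ k<m))
  ... | y , p , len with strong-exchange y (conj a [ s ]) Ny
    where
    a : Word n
    a = alt t s k
    not-in-a : N a [ s ] ≡ false
    not-in-a = trans (N-alt t s k [ s ]) (xor<-false k (λ i i<k → dec-false ([ s ] ≈W? alt t s (suc (i ℕ.* 2)))
      (λ q → alt-not-identity s≢t (suc i) (s≤s z≤n) (ℕₚ.≤-<-trans i<k k<m)
        (transW (++-congˡW [ s ] (symW q)) (square [] [] s)))))
    Ny : N y (conj a [ s ]) ≡ true
    Ny = begin
      N y (conj a [ s ])                  ≡⟨ cong (_xor N y (conj a [ s ])) not-in-a ⟨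
      N a [ s ] xor N y (conj a [ s ])    ≡⟨ N-++ a y [ s ] ⟨
      N (a ++ y) [ s ]                    ≡⟨ N-≈W p [ s ] ⟩
      N u [ s ]                           ≡⟨ Ns ⟩
      true                                ∎
      where open ≡-Reasoning
  ...   | z , len′ , q = z , symW (shift-left (symW az≈su)) , trans (trans (sym (ℕₚ.+-suc k (length z))) (cong (k ℕ.+_) len′)) len
    where
    a : Word n
    a = alt t s k
    az≈su : a ++ z ≈W s ∷ u
    az≈su = transW (++-congˡW a (symW q)) (transW (≡⇒≈W (sym (++-assoc a (conj a [ s ]) y)))
      (transW (++-congʳW y (++-conj a [ s ])) (++-congˡW [ s ] p)))

  length-alt-++ : ∀ {s t : Fin n} k (y : Word n) → length (alt s t k ++ y) ≡ k ℕ.+ length y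
  length-alt-++ {s} {t} k y = trans (length-++ (alt s t k)) (cong (ℕ._+ length y) (length-alt s t k))

  dihedral-split : ∀ {s t u v} → s ≢ t → IsReduced (s ∷ u) → s ∷ u ≈W t ∷ v → length u ≡ length v →
    ∃ λ y → u ≈W alt t s (m′ s t) ++ y × v ≈W alt s t (m′ s t) ++ y × m′ s t ℕ.+ length y ≡ length u
  dihedral-split {s} {t} {u} {v} s≢t red p len
    with dihedral-prefix (m s t) (s ∷ u) s≢t (descent-head red) (descent red p (cong suc len)) ℕₚ.≤-refl
  ... | y , q , len′ =
    y , ++-cancelˡW [ s ] (symW q′) , ++-cancelˡW [ t ] (transW (symW p) (transW (symW q′) (≈B⇒≈W (braid-alt s≢t y)))) ,
    ℕₚ.suc-injective (trans (cong (ℕ._+ length y) (sym (m≡1+m′ s≢t))) len′)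
    where
    q′ : s ∷ alt t s (m′ s t) ++ y ≈W s ∷ u
    q′ = subst (λ a → a ++ y ≈W s ∷ u) (alt-m s≢t) q

  -- Matsumoto's theorem. If the first letters differ, both are descents of the same element, so
  -- `dihedral-split` supplies two intermediate words that differ by one braid move; each shares its
  -- first letter with one of the given words, and induction applies to the tails.
  matsumoto : ∀ {u v} → IsReduced u → IsReduced v → u ≈W v → u ≈B v
  matsumoto {u} red-u red-v = go (length u) red-u red-v refl
    where
    go : ∀ l {u v} → IsReduced u → IsReduced v → length u ≡ l → u ≈W v → u ≈B v
    go l {[]} {[]} red-u red-v len p = reflB
    go l {[]} {t ∷ v} red-u red-v len p with () ← reduced-length red-u red-v p
    go l {s ∷ u} {[]} red-u red-v len p with () ← reduced-length red-u red-v p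
    go (suc l) {s ∷ u} {t ∷ v} red-u red-v len p with s ≟ t
    ... | yes refl = ++-congˡB [ s ] (go l (reduced-++ʳ [ s ] red-u) (reduced-++ʳ [ s ] red-v) (ℕₚ.suc-injective len) (++-cancelˡW [ s ] p))
    ... | no  s≢t  with len-uv ← ℕₚ.suc-injective (reduced-length red-u red-v p)
                   with dihedral-split s≢t red-u p len-uv
    ...   | y , p₁ , p₂ , len-y =
      transB (++-congˡB [ s ] (go l red-u′ (reduced-resp red-u′ (symW p₁) (trans (length-alt-++ (m′ s t) y) len-y)) (ℕₚ.suc-injective len) p₁))
        (transB (braid-alt s≢t y)
          (++-congˡB [ t ] (symB (go l red-v′ (reduced-resp red-v′ (symW p₂) (trans (length-alt-++ (m′ s t) y) (trans len-y len-uv)))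
             (trans (sym len-uv) (ℕₚ.suc-injective len)) p₂))))
      where
      red-u′ : IsReduced u
      red-u′ = reduced-++ʳ [ s ] red-u
      red-v′ : IsReduced v
      red-v′ = reduced-++ʳ [ t ] red-v

  -- The equation is sent to W, where letters can be cancelled, and the result is lifted back by
  -- `matsumoto`; the lift is what restricts this argument to reduced words.
  reduced-Reduct : ∀ {s u t v} → IsReduced (s ∷ u) → s ∷ u ≈B t ∷ v → Reduct s u t v
  reduced-Reduct {s} {u} {t} {v} red p with s ≟ t
  ... | yes refl = inj₁ (refl , matsumoto (reduced-++ʳ [ s ] red) red-v (++-cancelˡW [ s ] (≈B⇒≈W p)))
    where
    red-v : IsReduced v
    red-v = reduced-++ʳ [ t ] (reduced-resp red (≈B⇒≈W (symB p)) (length-≈B (symB p)))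
  ... | no s≢t with len-uv ← ℕₚ.suc-injective (length-≈B p)
               with dihedral-split s≢t red (≈B⇒≈W p) len-uv
  ...   | y , p₁ , p₂ , len-y = inj₂ (s≢t , y ,
      matsumoto red-u (reduced-resp red-u (symW p₁) (trans (length-alt-++ (m′ s t) y) len-y)) p₁ ,
      matsumoto red-v (reduced-resp red-v (symW p₂) (trans (length-alt-++ (m′ s t) y) (trans len-y len-uv))) p₂)
    where
    red-u : IsReduced u
    red-u = reduced-++ʳ [ s ] red
    red-v : IsReduced v
    red-v = reduced-++ʳ [ t ] (reduced-resp red (≈B⇒≈W (symB p)) (length-≈B (symB p)))

  refl-word : Word n → Fin n → Word n
  refl-word p s = p ++ s ∷ reverse p

  refl-word-++ : ∀ p s w → refl-word p s ++ (p ++ w) ≈W p ++ s ∷ w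
  refl-word-++ p s w = transW (≡⇒≈W (++-assoc p (s ∷ reverse p) (p ++ w))) (++-congˡW p (++-congˡW [ s ] (++-inverseˡW p w)))

  conj-refl-word : ∀ p s → conj p (refl-word p s) ≈W [ s ]
  conj-refl-word p s = ++-cancelˡW p (transW (++-conj p (refl-word p s))
    (transW (≡⇒≈W (cong (refl-word p s ++_) (sym (++-identityʳ p)))) (refl-word-++ p s [])))

  -- The word p s p⁻¹ need not be reduced: the contributions of p and of its reversal cancel,
  -- because together they count for p p⁻¹, and the middle letter counts once.
  N-refl-word-self : ∀ p s → N (refl-word p s) (refl-word p s) ≡ true
  N-refl-word-self p s = begin
    N x x                                                                        ≡⟨ N-++ p (s ∷ reverse p) x ⟩
    N p x xor (does (y ≈W? [ s ]) xor N (reverse p) (s ∷ y ∷ʳ s))                ≡⟨ cong₂ (λ a b → N p x xor (a xor b)) (dec-true (y ≈W? [ s ]) y≈s) (N-cong (reverse p) (transW (sxs-cong s y≈s) (transW (square [] [ s ] s) (symW y≈s)))) ⟩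
    N p x xor not (N (reverse p) y)                                              ≡⟨ xor-not (N p x) (N (reverse p) y) ⟩
    not (N p x xor N (reverse p) y)                                              ≡⟨ cong not (N-++ p (reverse p) x) ⟨
    not (N (p ++ reverse p) x)                                                   ≡⟨ cong not (N-≈W (transW (≡⇒≈W (cong (p ++_) (sym (++-identityʳ (reverse p))))) (++-inverseʳW p [])) x) ⟩
    true                                                                         ∎
    where
    open ≡-Reasoning
    x y : Word n
    x = refl-word p s
    y = conj p x
    y≈s : y ≈W [ s ]
    y≈s = conj-refl-word p s
    xor-not : ∀ a b → a xor not b ≡ not (a xor b)
    xor-not false b = refl
    xor-not true  b = refl

  N-refl-word-++ : ∀ p s w → N (refl-word p s ++ w) (refl-word p s) ≡ not (N w (refl-word p s))
  N-refl-word-++ p s w = trans (N-++ x w x) (cong₂ _xor_ (N-refl-word-self p s) (N-cong w (++-cancelˡW x (++-conj x x))))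
    where
    x : Word n
    x = refl-word p s

  refl-word-involutive : ∀ p s w → refl-word p s ++ (refl-word p s ++ w) ≈W w
  refl-word-involutive p s w = transW (≡⇒≈W (cong (refl-word p s ++_) (++-assoc p (s ∷ reverse p) w)))
    (transW (refl-word-++ p s (s ∷ reverse p ++ w)) (transW (square p (reverse p ++ w) s) (++-inverseʳW p w)))

  module Longest (w₀ : Word n) (longest : IsLongestReduced w₀) where

    w₀-reduced : IsReduced w₀
    w₀-reduced = proj₁ longest

    -- Otherwise the reflection x would be an inversion of x w₀, and exchange would turn a reduced
    -- word for x w₀ into a word for w₀ with one letter less, making x w₀ longer than w₀.
    N-w₀ : ∀ p s → N w₀ (refl-word p s) ≡ true
    N-w₀ p s with N w₀ (refl-word p s) in eq
    ... | true  = refl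
    ... | false with reduce (refl-word p s ++ w₀)
    ...   | v , red , v≈xw₀ with strong-exchange v (refl-word p s) (trans (N-≈W v≈xw₀ (refl-word p s)) (trans (N-refl-word-++ p s w₀) (cong not eq)))
    ...     | y , len , xv≈y = contradiction (w₀-reduced y y≈w₀) (ℕₚ.<⇒≱ (subst (_≤ length w₀) (sym len) (proj₂ longest v red)))
      where
      y≈w₀ : y ≈W w₀
      y≈w₀ = transW (symW xv≈y) (transW (++-congˡW (refl-word p s) v≈xw₀) (refl-word-involutive p s w₀))

    -- The letters of `q` move into the prefix one at a time. The reflection p s p⁻¹ is not an
    -- inversion of p, since p s is reduced, but it is one of w₀ = p v; hence s is a descent of v
    -- and can be split off.
    extend-prefix : ∀ q p v → IsReduced (p ++ q) → p ++ v ≈W w₀ → length p ℕ.+ length v ≡ length w₀ →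
                    ∃ λ v′ → (p ++ q) ++ v′ ≈W w₀ × length (p ++ q) ℕ.+ length v′ ≡ length w₀
    extend-prefix [] p v red eq len = v , subst (λ u → u ++ v ≈W w₀) (sym (++-identityʳ p)) eq ,
      subst (λ u → length u ℕ.+ length v ≡ length w₀) (sym (++-identityʳ p)) len
    extend-prefix (s ∷ q) p v red eq len with strong-exchange v [ s ] Nv
      where
      x : Word n
      x = refl-word p s
      Np : N p x ≡ false
      Np with N p x in eq′
      ... | false = refl
      ... | true with strong-exchange p x eq′
      ...   | y , len′ , xp≈y = contradiction
        (reduced-++ˡ (p ∷ʳ s) (subst IsReduced (sym (++-assoc p [ s ] q)) red) y
          (transW (symW xp≈y) (transW (≡⇒≈W (cong (x ++_) (sym (++-identityʳ p)))) (refl-word-++ p s []))))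
        (ℕₚ.<⇒≱ (subst (length y <_) (sym (length-++ p)) (ℕₚ.≤-trans (ℕₚ.≤-reflexive len′) (ℕₚ.m≤m+n (length p) 1))))
      Nv : N v [ s ] ≡ true
      Nv = begin
        N v [ s ]                 ≡⟨ N-cong v (conj-refl-word p s) ⟨
        N v (conj p x)            ≡⟨ cong (_xor N v (conj p x)) Np ⟨
        N p x xor N v (conj p x)  ≡⟨ N-++ p v x ⟨
        N (p ++ v) x              ≡⟨ N-≈W eq x ⟩
        N w₀ x                    ≡⟨ N-w₀ p s ⟩
        true                      ∎
        where open ≡-Reasoning
    ... | y , len′ , sv≈y with extend-prefix q (p ∷ʳ s) y (subst IsReduced (sym (++-assoc p [ s ] q)) red)
                                (transW (≡⇒≈W (++-assoc p [ s ] y)) (transW (++-congˡW p (symW (shift-left sv≈y))) eq))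
                                (trans (trans (cong (ℕ._+ length y) (length-++ p)) (trans (ℕₚ.+-assoc (length p) 1 (length y)) (cong (length p ℕ.+_) len′))) len)
    ...   | v′ , eq′ , len″ = v′ , subst (λ u → u ++ v′ ≈W w₀) (++-assoc p [ s ] q) eq′ ,
                                   subst (λ u → length u ℕ.+ length v′ ≡ length w₀) (++-assoc p [ s ] q) len″

    w₀-unique : ∀ {u} → IsReduced u → length u ≡ length w₀ → u ≈B w₀
    w₀-unique {u} red len with extend-prefix u [] w₀ red reflW refl
    ... | []    , eq , _    = matsumoto red w₀-reduced (transW (≡⇒≈W (sym (++-identityʳ u))) eq)
    ... | _ ∷ v , _  , len′ = contradiction (trans len′ (sym len)) (ℕₚ.m+1+n≢m (length u))

    w₀-palindrome : reverse w₀ ≈B w₀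
    w₀-palindrome = w₀-unique (λ v v≈ → subst₂ _≤_ (sym (length-reverse w₀)) (length-reverse v)
        (w₀-reduced (reverse v) (transW (reverse-≈W v≈) (≡⇒≈W (reverse-involutive w₀)))))
      (length-reverse w₀)

    w₀-lcm : ∀ {s t} → s ≢ t → ∃ λ y → s ∷ alt t s (m′ s t) ++ y ≈B w₀
    w₀-lcm {s} {t} s≢t with dihedral-prefix (m s t) w₀ s≢t (N-w₀ [] s) (N-w₀ [] t) ℕₚ.≤-refl
    ... | y , p , len = y , subst (λ a → a ++ y ≈B w₀) (alt-m s≢t)
      (matsumoto (reduced-resp w₀-reduced p (trans (length-alt-++ (m s t) y) len)) w₀-reduced p)

-- Divisibility in the braid monoid

module Divisibility {n : ℕ} (M : CoxeterMatrix n) where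
  open Artin M

  ≼-++ : ∀ u v → u ≼ u ++ v
  ≼-++ u v = v , reflB

  []-≼ : ∀ u → [] ≼ u
  []-≼ u = u , reflB

  ≼-respʳ : ∀ {u v w} → u ≼ v → v ≈B w → u ≼ w
  ≼-respʳ (x , p) q = x , transB p q

  ≼-respˡ : ∀ {u v w} → u ≈B v → v ≼ w → u ≼ w
  ≼-respˡ p (x , q) = x , transB (++-congʳB x p) q

  ≼-reflexive : ∀ {u v} → u ≈B v → u ≼ v
  ≼-reflexive {u} p = [] , transB (≡⇒≈B (++-identityʳ u)) p

  ≼-trans : ∀ {u v w} → u ≼ v → v ≼ w → u ≼ w
  ≼-trans {u} (x , p) (y , q) = x ++ y , transB (≡⇒≈B (sym (++-assoc u x y))) (transB (++-congʳB y p) q)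

  ++-≼ : ∀ x {u v} → u ≼ v → x ++ u ≼ x ++ v
  ++-≼ x {u} (y , p) = y , transB (≡⇒≈B (++-assoc x u y)) (++-congˡB x p)

  -- Least common multiples exist, and are least, inside any class of words that is closed under right factors
  -- and in which two factorisations with distinct first letters have the expected common reduct.
  module LCM (Good : Word n → Set)
    (good-resp : ∀ {u v} → u ≈B v → Good u → Good v)
    (good-tail : ∀ {s u} → Good (s ∷ u) → Good u)
    (good-reduct : ∀ {s u t v} → Good (s ∷ u) → s ∷ u ≈B t ∷ v → Reduct s u t v)
    where

    good-++ʳ : ∀ u {v} → Good (u ++ v) → Good v
    good-++ʳ []      g = g
    good-++ʳ (s ∷ u) g = good-++ʳ u (good-tail g)

    ∷-cancel : ∀ {s u v} → Good (s ∷ u) → s ∷ u ≈B s ∷ v → u ≈B v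
    ∷-cancel g p with good-reduct g p
    ... | inj₁ (_ , q)   = q
    ... | inj₂ (s≢s , _) = contradiction refl s≢s

    ++-cancel : ∀ x {u v} → Good (x ++ u) → x ++ u ≈B x ++ v → u ≈B v
    ++-cancel []      g p = p
    ++-cancel (s ∷ x) g p = ++-cancel x (good-tail g) (∷-cancel g p)

    ++-cancel-≼ : ∀ x {u v} → Good (x ++ v) → x ++ u ≼ x ++ v → u ≼ v
    ++-cancel-≼ x {u} g (y , p) = y , ++-cancel x (good-resp (symB p′) g) p′
      where
      p′ : x ++ (u ++ y) ≈B x ++ _
      p′ = transB (≡⇒≈B (sym (++-assoc x u y))) p

    record Lcm (a b y : Word n) : Set where
      field
        join  : Word n
        left  : a ≼ join
        right : b ≼ join
        below : join ≼ y
        least : ∀ x → Good x → a ≼ x → b ≼ x → join ≼ x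
    open Lcm

    lcm-same : ∀ {s a b y} → Good (s ∷ y) → Lcm a b y → Lcm (s ∷ a) (s ∷ b) (s ∷ y)
    lcm-same {s} g d .join  = s ∷ d .join
    lcm-same {s} g d .left  = ++-≼ [ s ] (d .left)
    lcm-same {s} g d .right = ++-≼ [ s ] (d .right)
    lcm-same {s} g d .below = ++-≼ [ s ] (d .below)
    lcm-same {s} {a} g d .least x gx (α , p) (β , q) =
      ≼-respʳ (++-≼ [ s ] (d .least (a ++ α) (good-tail gx′) (≼-++ a α) (β , ∷-cancel (good-resp (symB q) gx) (transB q (symB p))))) p
      where
      gx′ : Good (s ∷ a ++ α)
      gx′ = good-resp (symB p) gx

    lcm-resp : ∀ {a b y z} → y ≈B z → Lcm a b y → Lcm a b z
    lcm-resp p d .join  = d .join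
    lcm-resp p d .left  = d .left
    lcm-resp p d .right = d .right
    lcm-resp p d .below = ≼-respʳ (d .below) p
    lcm-resp p d .least = d .least

    -- A common multiple of s a and t b is a multiple of lcm(s,t) = s A₁ = t A₂, hence of s lcm(a,
    -- A₁) = s A₁ F₁ and of t lcm(b, A₂) = s A₁ F₂, in the notation of the proof. So the lcm sought
    -- is lcm(s,t) followed by lcm(F₁, F₂).
    lcm-distinct : ∀ {s t a b y z w} → s ≢ t → Good (s ∷ y) →
      y ≈B alt t s (m′ s t) ++ w → z ≈B alt s t (m′ s t) ++ w → s ∷ y ≈B t ∷ z →
      (c₁ : Lcm a (alt t s (m′ s t)) y) (c₂ : Lcm b (alt s t (m′ s t)) z) →
      (∀ f₁ f₂ → f₁ ≼ w → f₂ ≼ w → Lcm f₁ f₂ w) → Lcm (s ∷ a) (t ∷ b) (s ∷ y)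
    lcm-distinct {s} {t} {a} {b} {y} {z} {w} s≢t g y≈ z≈ sy≈tz c₁ c₂ rec = result
      where
      A₁ A₂ F₁ F₂ : Word n
      A₁ = alt t s (m′ s t)
      A₂ = alt s t (m′ s t)
      F₁ = proj₁ (c₁ .right)
      F₂ = proj₁ (c₂ .right)
      A₁F₁≈c₁ : A₁ ++ F₁ ≈B c₁ .join
      A₁F₁≈c₁ = proj₂ (c₁ .right)
      A₂F₂≈c₂ : A₂ ++ F₂ ≈B c₂ .join
      A₂F₂≈c₂ = proj₂ (c₂ .right)
      good-z : Good z
      good-z = good-tail (good-resp sy≈tz g)
      d : Lcm F₁ F₂ w
      d = rec F₁ F₂ (++-cancel-≼ A₁ (good-resp y≈ (good-tail g)) (≼-respˡ A₁F₁≈c₁ (≼-respʳ (c₁ .below) y≈)))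
                    (++-cancel-≼ A₂ (good-resp z≈ good-z) (≼-respˡ A₂F₂≈c₂ (≼-respʳ (c₂ .below) z≈)))
      D : Word n
      D = s ∷ A₁ ++ d .join
      result : Lcm (s ∷ a) (t ∷ b) (s ∷ y)
      result .join  = D
      result .left  = ≼-trans (++-≼ [ s ] (≼-respʳ (c₁ .left) (symB A₁F₁≈c₁))) (++-≼ (s ∷ A₁) (d .left))
      result .right = ≼-respʳ (≼-trans (++-≼ [ t ] (≼-respʳ (c₂ .left) (symB A₂F₂≈c₂))) (++-≼ (t ∷ A₂) (d .right)))
                              (symB (braid-alt s≢t (d .join)))
      result .below = ≼-respʳ (++-≼ (s ∷ A₁) (d .below)) (++-congˡB [ s ] (symB y≈))
      result .least x gx (α , p) (β , q) with good-reduct (good-resp (symB p) gx) (transB p (symB q))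
      ... | inj₁ (s≡t , _)               = contradiction s≡t s≢t
      ... | inj₂ (_ , w′ , aα≈ , bβ≈) =
        ≼-respʳ (++-≼ (s ∷ A₁) (d .least w′ (good-++ʳ A₁ (good-resp aα≈ good-aα))
          (++-cancel-≼ A₁ (good-resp aα≈ good-aα) (≼-respˡ A₁F₁≈c₁ (≼-respʳ (c₁ .least (a ++ α) good-aα (≼-++ a α) (w′ , symB aα≈)) aα≈)))
          (++-cancel-≼ A₂ (good-resp bβ≈ good-bβ) (≼-respˡ A₂F₂≈c₂ (≼-respʳ (c₂ .least (b ++ β) good-bβ (≼-++ b β) (w′ , symB bβ≈)) bβ≈)))))
          (transB (++-congˡB [ s ] (symB aα≈)) p)
        where
        good-aα : Good (a ++ α)
        good-aα = good-tail (good-resp (symB p) gx)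
        good-bβ : Good (b ++ β)
        good-bβ = good-tail (good-resp (symB q) gx)

    -- The alternating words that enter in the recursive calls can be longer than `a` and `b`; what
    -- decreases is the length of the given common multiple `y`.
    lcm-fuel : ∀ l a b y → length y ≤ l → Good y → a ≼ y → b ≼ y → Lcm a b y
    lcm-fuel l [] b y len g a≼y b≼y = record
      { join = b ; left = []-≼ b ; right = ≼-reflexive reflB ; below = b≼y ; least = λ _ _ _ b≼x → b≼x }
    lcm-fuel l (s ∷ a) [] y len g a≼y b≼y = record
      { join = s ∷ a ; left = ≼-reflexive reflB ; right = []-≼ (s ∷ a) ; below = a≼y ; least = λ _ _ a≼x _ → a≼x }
    lcm-fuel zero (s ∷ a) (t ∷ b) y len g (α , p) b≼y = contradiction (subst (_≤ 0) (sym (length-≈B p)) len) λ ()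
    lcm-fuel (suc l) (s ∷ a) (t ∷ b) y len g (α , p) (β , q) with good-reduct (good-resp (symB p) g) (transB p (symB q))
    ... | inj₁ (refl , aα≈bβ) = lcm-resp p (lcm-same good-saα
            (lcm-fuel l a b (a ++ α) len-aα (good-tail good-saα) (≼-++ a α) (β , symB aα≈bβ)))
      where
      good-saα : Good (s ∷ a ++ α)
      good-saα = good-resp (symB p) g
      len-aα : length (a ++ α) ≤ l
      len-aα = ℕ.s≤s⁻¹ (subst (_≤ suc l) (sym (length-≈B p)) len)
    ... | inj₂ (s≢t , w , aα≈ , bβ≈) = lcm-resp p (lcm-distinct s≢t good-saα aα≈ bβ≈ (transB p (symB q))
            (lcm-fuel l a (alt t s (m′ s t)) (a ++ α) len-aα (good-tail good-saα) (≼-++ a α) (w , symB aα≈))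
            (lcm-fuel l b (alt s t (m′ s t)) (b ++ β) len-bβ (good-tail (good-resp (symB q) g)) (≼-++ b β) (w , symB bβ≈))
            (λ f₁ f₂ → lcm-fuel l f₁ f₂ w len-w (good-++ʳ (alt t s (m′ s t)) (good-resp aα≈ (good-tail good-saα)))))
      where
      good-saα : Good (s ∷ a ++ α)
      good-saα = good-resp (symB p) g
      len-aα : length (a ++ α) ≤ l
      len-aα = ℕ.s≤s⁻¹ (subst (_≤ suc l) (sym (length-≈B p)) len)
      len-bβ : length (b ++ β) ≤ l
      len-bβ = ℕ.s≤s⁻¹ (subst (_≤ suc l) (sym (length-≈B q)) len)
      len-w : length w ≤ l
      len-w = ℕₚ.≤-trans (ℕₚ.m≤n+m (length w) (length (alt t s (m′ s t))))
        (ℕₚ.≤-trans (ℕₚ.≤-reflexive (trans (sym (length-++ (alt t s (m′ s t)))) (sym (length-≈B aα≈)))) len-aα)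

    lcm : ∀ a b y → Good y → a ≼ y → b ≼ y → Lcm a b y
    lcm a b y = lcm-fuel (length y) a b y ℕₚ.≤-refl

-- The reduction lemma for arbitrary words

module Reduction {n : ℕ} (M : CoxeterMatrix n) (_≈W?_ : ∀ u v → Dec (Coxeter._≈W_ M u v))
  (w₀ : Word n) (longest : Coxeter.IsLongestReduced M w₀) where
  open Artin M
  open ReducedWords M _≈W?_
  open Longest w₀ longest
  open Divisibility M

  module Step (l : ℕ) (reduct-below : ∀ {s u t v} → length u < l → s ∷ u ≈B t ∷ v → Reduct s u t v) where

    Good : Word n → Set
    Good u = length u ≤ l ⊎ IsReduced u

    good-resp : ∀ {u v} → u ≈B v → Good u → Good v
    good-resp p (inj₁ len) = inj₁ (subst (_≤ l) (length-≈B p) len)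
    good-resp p (inj₂ red) = inj₂ (reduced-resp red (≈B⇒≈W (symB p)) (sym (length-≈B p)))

    good-tail : ∀ {s u} → Good (s ∷ u) → Good u
    good-tail (inj₁ len) = inj₁ (ℕₚ.≤-trans (ℕₚ.n≤1+n _) len)
    good-tail {s} (inj₂ red) = inj₂ (reduced-++ʳ [ s ] red)

    good-reduct : ∀ {s u t v} → Good (s ∷ u) → s ∷ u ≈B t ∷ v → Reduct s u t v
    good-reduct (inj₁ len) = reduct-below len
    good-reduct (inj₂ red) = reduced-Reduct red

    open LCM Good good-resp good-tail good-reduct

    -- With D = lcm(a, b), the word r D divides w₀, hence is reduced, and this
    -- reduces the comparison of s and t to reduced words.
    Reduct-trans-distinct : ∀ {s r t u y v} → length y ≤ l → s ≢ r → r ≢ t → s ≢ t →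
      Reduct s u r y → Reduct r y t v → Reduct s u t v
    Reduct-trans-distinct len s≢r r≢t s≢t (inj₁ (s≡r , _)) _ = contradiction s≡r s≢r
    Reduct-trans-distinct len s≢r r≢t s≢t _ (inj₁ (r≡t , _)) = contradiction r≡t r≢t
    Reduct-trans-distinct {s} {r} {t} {u} {y} {v} len s≢r r≢t s≢t (inj₂ (_ , p , u≈ , y≈ap)) (inj₂ (_ , q , y≈bq , v≈)) =
      Reduct-resp (transB u≈ (transB (++-congˡB a′ p≈a″z) (≡⇒≈B (sym (++-assoc a′ a″ z)))))
                  (symB (transB v≈ (transB (++-congˡB b′ q≈b″z) (≡⇒≈B (sym (++-assoc b′ b″ z))))))
                  -- The equation s a′ a″ = r D = t b′ b″ is between reduced words; `extend`
                  -- restores the factor z of y = D z.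
                  (extend (reduced-Reduct reduced-sa′a″ (transB (braid-alt s≢r a″) (transB (++-congˡB [ r ] (transB aa″≈D (symB bb″≈D))) (braid-alt r≢t b″)))))
      where
      a a′ b b′ : Word n
      a  = alt s r (m′ s r)
      a′ = alt r s (m′ s r)
      b  = alt t r (m′ r t)
      b′ = alt r t (m′ r t)
      D : Lcm a b y
      D = lcm a b y (inj₁ len) (p , symB y≈ap) (q , symB y≈bq)
      open Lcm D using (join; left; right; below; least)
      a″ b″ z : Word n
      a″ = proj₁ left
      b″ = proj₁ right
      z  = proj₁ below
      aa″≈D : a ++ a″ ≈B join
      aa″≈D = proj₂ left
      bb″≈D : b ++ b″ ≈B join
      bb″≈D = proj₂ right
      Dz≈y : join ++ z ≈B y
      Dz≈y = proj₂ below
      p≈a″z : p ≈B a″ ++ z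
      p≈a″z = ++-cancel a (good-resp y≈ap (inj₁ len))
        (transB (symB y≈ap) (transB (symB Dz≈y) (transB (++-congʳB z (symB aa″≈D)) (≡⇒≈B (++-assoc a a″ z)))))
      q≈b″z : q ≈B b″ ++ z
      q≈b″z = ++-cancel b (good-resp y≈bq (inj₁ len))
        (transB (symB y≈bq) (transB (symB Dz≈y) (transB (++-congʳB z (symB bb″≈D)) (≡⇒≈B (++-assoc b b″ z)))))
      x₁ x₂ : Word n
      x₁ = proj₁ (w₀-lcm s≢r)
      x₂ = proj₁ (w₀-lcm r≢t)
      rax₁≈w₀ : r ∷ a ++ x₁ ≈B w₀
      rax₁≈w₀ = transB (symB (braid-alt s≢r x₁)) (proj₂ (w₀-lcm s≢r))
      rbx₂≈w₀ : r ∷ b ++ x₂ ≈B w₀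
      rbx₂≈w₀ = proj₂ (w₀-lcm r≢t)
      reduced-rax₁ : IsReduced (r ∷ a ++ x₁)
      reduced-rax₁ = reduced-resp w₀-reduced (≈B⇒≈W rax₁≈w₀) (length-≈B rax₁≈w₀)
      -- Both r a x₁ and r b x₂ are equal to w₀; cancelling r makes a x₁ a common multiple of a and
      -- b, to which the leastness of D applies.
      D≼ax₁ : join ≼ a ++ x₁
      D≼ax₁ = least (a ++ x₁) (good-tail (inj₂ reduced-rax₁)) (≼-++ a x₁)
        (x₂ , ∷-cancel (inj₂ (reduced-resp w₀-reduced (≈B⇒≈W rbx₂≈w₀) (length-≈B rbx₂≈w₀))) (transB rbx₂≈w₀ (symB rax₁≈w₀)))
      reduced-rD : IsReduced (r ∷ join)
      reduced-rD = reduced-++ˡ (r ∷ join) {proj₁ D≼ax₁} (reduced-resp reduced-rax₁ (≈B⇒≈W rDx≈) (length-≈B rDx≈))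
        where
        rDx≈ : r ∷ join ++ proj₁ D≼ax₁ ≈B r ∷ a ++ x₁
        rDx≈ = ++-congˡB [ r ] (proj₂ D≼ax₁)
      reduced-sa′a″ : IsReduced (s ∷ a′ ++ a″)
      reduced-sa′a″ = reduced-resp reduced-rD (≈B⇒≈W sa′a″≈) (length-≈B sa′a″≈)
        where
        sa′a″≈ : s ∷ a′ ++ a″ ≈B r ∷ join
        sa′a″≈ = transB (braid-alt s≢r a″) (++-congˡB [ r ] aa″≈D)
      extend : Reduct s (a′ ++ a″) t (b′ ++ b″) → Reduct s ((a′ ++ a″) ++ z) t ((b′ ++ b″) ++ z)
      extend (inj₁ (s≡t , _)) = contradiction s≡t s≢t
      extend (inj₂ (_ , w , e₁ , e₂)) = inj₂ (s≢t , w ++ z ,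
        transB (++-congʳB z e₁) (≡⇒≈B (++-assoc (alt t s (m′ s t)) w z)) ,
        transB (++-congʳB z e₂) (≡⇒≈B (++-assoc (alt s t (m′ s t)) w z)))

    Reduct-trans-back : ∀ {s r u y v} → length y ≤ l → Reduct s u r y → Reduct r y s v → Reduct s u s v
    Reduct-trans-back len (inj₁ (refl , p)) (inj₁ (_ , q)) = inj₁ (refl , transB p q)
    Reduct-trans-back len (inj₁ (refl , p)) (inj₂ (r≢r , _)) = contradiction refl r≢r
    Reduct-trans-back len (inj₂ (r≢r , _)) (inj₁ (refl , _)) = contradiction refl r≢r
    Reduct-trans-back {s} {r} len (inj₂ (_ , p , u≈ , y≈ap)) (inj₂ (_ , q , y≈aq , v≈)) rewrite m′-comm r s =
      inj₁ (refl , transB u≈ (transB (++-congˡB _ (++-cancel (alt s r (m′ s r)) (good-resp y≈ap (inj₁ len)) (transB (symB y≈ap) y≈aq))) (symB v≈)))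

    Reduct-trans : ∀ {s r t u y v} → length y ≤ l → Reduct s u r y → Reduct r y t v → Reduct s u t v
    Reduct-trans {s} {r} {t} len R₁ R₂ with s ≟ t | s ≟ r | r ≟ t
    ... | yes refl | _        | _        = Reduct-trans-back len R₁ R₂
    ... | no  s≢t  | no s≢r   | no r≢t   = Reduct-trans-distinct len s≢r r≢t s≢t R₁ R₂
    ... | no  s≢t  | no s≢r   | yes refl with R₂
    ...   | inj₁ (_ , p)   = Reduct-resp reflB p R₁
    ...   | inj₂ (t≢t , _) = contradiction refl t≢t
    Reduct-trans {s} {r} {t} len R₁ R₂ | no s≢t | yes refl | _ with R₁
    ...   | inj₁ (_ , p)   = Reduct-resp p reflB R₂
    ...   | inj₂ (s≢s , _) = contradiction refl s≢s

    HeadReduct : Word n → Word n → Set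
    HeadReduct []      []      = ⊤
    HeadReduct []      (t ∷ v) = ⊥
    HeadReduct (s ∷ u) []      = ⊥
    HeadReduct (s ∷ u) (t ∷ v) = Reduct s u t v

    -- Induction on the derivation of the equality. Only a braid move at the very front changes the
    -- first letter, and it is an instance of the lcm case; the weight lies in transitivity.
    headReduct : ∀ {u v} → length u ≤ suc l → u ≈B v → HeadReduct u v
    headReduct len (braid [] v s t s≢t) =
      subst (λ k → HeadReduct (alt s t k ++ v) (alt t s k ++ v)) (sym (m≡1+m′ s≢t)) (inj₂ (s≢t , v , reflB , reflB))
    headReduct len (braid (x ∷ u) v s t s≢t) = inj₁ (refl , braid u v s t s≢t)
    headReduct {[]}    len reflB = tt
    headReduct {s ∷ u} len reflB = inj₁ (refl , reflB)
    headReduct {u} {v} len (symB p) = HeadReduct-sym v u (headReduct (subst (_≤ suc l) (sym (length-≈B p)) len) p)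
      where
      HeadReduct-sym : ∀ u v → HeadReduct u v → HeadReduct v u
      HeadReduct-sym []      []      r = tt
      HeadReduct-sym (s ∷ u) (t ∷ v) r = Reduct-sym r
    headReduct {u} {w} len (transB {v = v} p q) =
      HeadReduct-trans u v w len′ (headReduct len p) (headReduct len′ q)
      where
      len′ : length v ≤ suc l
      len′ = subst (_≤ suc l) (length-≈B p) len
      HeadReduct-trans : ∀ u v w → length v ≤ suc l → HeadReduct u v → HeadReduct v w → HeadReduct u w
      HeadReduct-trans []      []      []      len r₁ r₂ = tt
      HeadReduct-trans (s ∷ u) (r ∷ v) (t ∷ w) len r₁ r₂ = Reduct-trans (ℕ.s≤s⁻¹ len) r₁ r₂

  reduct-below : ∀ l {s u t v} → length u < l → s ∷ u ≈B t ∷ v → Reduct s u t v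
  reduct-below (suc l) len p = Step.headReduct l (reduct-below l) len p

  reduct : ∀ {s u t v} → s ∷ u ≈B t ∷ v → Reduct s u t v
  reduct {u = u} = reduct-below (suc (length u)) ℕₚ.≤-refl

-- Decidability

-- Warshall's algorithm: Reach vs x y means that y can be reached from x through intermediate points in vs.
module Warshall {A : Set} (R : A → A → Set) (R? : ∀ x y → Dec (R x y)) where

  Reach : List A → A → A → Set
  Reach []       x y = R x y
  Reach (v ∷ vs) x y = Reach vs x y ⊎ (Reach vs x v × Reach vs v y)

  reach? : ∀ vs x y → Dec (Reach vs x y)
  reach? []       x y = R? x y
  reach? (v ∷ vs) x y = reach? vs x y ⊎-dec (reach? vs x v ×-dec reach? vs v y)

  reach-base : ∀ vs {x y} → R x y → Reach vs x y
  reach-base []       r = r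
  reach-base (v ∷ vs) r = inj₁ (reach-base vs r)

  -- If the paths meet at the head v of the list, their loops at v are discarded, because `Reach`
  -- splits a path at v only once.
  reach-trans : ∀ {vs x y z} → y ∈ vs → Reach vs x y → Reach vs y z → Reach vs x z
  reach-trans {v ∷ vs} (here refl) p q = inj₂ (to-v p , from-v q)
    where
    to-v : ∀ {x} → Reach (v ∷ vs) x v → Reach vs x v
    to-v (inj₁ p)       = p
    to-v (inj₂ (p , _)) = p
    from-v : ∀ {z} → Reach (v ∷ vs) v z → Reach vs v z
    from-v (inj₁ p)       = p
    from-v (inj₂ (_ , p)) = p
  reach-trans (there y∈) (inj₁ p)        (inj₁ q)        = inj₁ (reach-trans y∈ p q)
  reach-trans (there y∈) (inj₁ p)        (inj₂ (q , q′)) = inj₂ (reach-trans y∈ p q , q′)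
  reach-trans (there y∈) (inj₂ (p , p′)) (inj₁ q)        = inj₂ (p , reach-trans y∈ p′ q)
  reach-trans (there y∈) (inj₂ (p , _))  (inj₂ (_ , q))  = inj₂ (p , q)

  reach-sym : (∀ {x y} → R x y → R y x) → ∀ vs {x y} → Reach vs x y → Reach vs y x
  reach-sym R-sym []       p              = R-sym p
  reach-sym R-sym (v ∷ vs) (inj₁ p)       = inj₁ (reach-sym R-sym vs p)
  reach-sym R-sym (v ∷ vs) (inj₂ (p , q)) = inj₂ (reach-sym R-sym vs q , reach-sym R-sym vs p)

  reach-sound : (_~_ : A → A → Set) → (∀ {x y} → R x y → x ~ y) → (∀ {x y z} → x ~ y → y ~ z → x ~ z) →
                ∀ vs {x y} → Reach vs x y → x ~ y
  reach-sound _~_ incl ~-trans []       p              = incl p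
  reach-sound _~_ incl ~-trans (v ∷ vs) (inj₁ p)       = reach-sound _~_ incl ~-trans vs p
  reach-sound _~_ incl ~-trans (v ∷ vs) (inj₂ (p , q)) = ~-trans (reach-sound _~_ incl ~-trans vs p) (reach-sound _~_ incl ~-trans vs q)

words : ∀ {n} → ℕ → List (Word n)
words zero    = [ [] ]
words (suc l) = concatMap (λ s → map (s ∷_) (words l)) (allFin _)

∈-words : ∀ {n} (w : Word n) → w ∈ words (length w)
∈-words []      = here refl
∈-words (s ∷ w) = ∈-concatMap⁺ (λ s → map (s ∷_) (words (length w))) (lose (∈-allFin s) (∈-map⁺ (s ∷_) (∈-words w)))

module Decidability {n : ℕ} (M : CoxeterMatrix n) where
  open Artin M

  -- The common remainder is written as `drop (m s t) u` rather than quantified, so that a decision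
  -- only has to search for the two letters.
  BraidAtHead : Word n → Word n → Set
  BraidAtHead u v = ∃ λ s → ∃ λ t → s ≢ t ×
    u ≡ alt s t (m s t) ++ drop (m s t) u × v ≡ alt t s (m s t) ++ drop (m s t) u

  Braid : Word n → Word n → Set
  Braid (x ∷ u) (y ∷ v) = BraidAtHead (x ∷ u) (y ∷ v) ⊎ (x ≡ y × Braid u v)
  Braid u       v       = BraidAtHead u v

  private
    _≡?_ : DecidableEquality (Word n)
    _≡?_ = ≡-dec _≟_

  braidAtHead? : ∀ u v → Dec (BraidAtHead u v)
  braidAtHead? u v = any? λ s → any? λ t → ¬? (s ≟ t) ×-dec
    ((u ≡? (alt s t (m s t) ++ drop (m s t) u)) ×-dec (v ≡? (alt t s (m s t) ++ drop (m s t) u)))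

  braid? : ∀ u v → Dec (Braid u v)
  braid? []      v       = braidAtHead? [] v
  braid? (x ∷ u) []      = braidAtHead? (x ∷ u) []
  braid? (x ∷ u) (y ∷ v) = braidAtHead? (x ∷ u) (y ∷ v) ⊎-dec ((x ≟ y) ×-dec braid? u v)

  BraidAtHead⇒≈B : ∀ {u v} → BraidAtHead u v → u ≈B v
  BraidAtHead⇒≈B {u} (s , t , s≢t , p , q) = subst₂ _≈B_ (sym p) (sym q) (braid [] (drop (m s t) u) s t s≢t)

  Braid⇒≈B : ∀ u v → Braid u v → u ≈B v
  Braid⇒≈B []      v       h                 = BraidAtHead⇒≈B h
  Braid⇒≈B (x ∷ u) []      h                 = BraidAtHead⇒≈B h
  Braid⇒≈B (x ∷ u) (y ∷ v) (inj₁ h)          = BraidAtHead⇒≈B h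
  Braid⇒≈B (x ∷ u) (y ∷ v) (inj₂ (refl , b)) = ++-congˡB [ x ] (Braid⇒≈B u v b)

  BraidAtHead⇒Braid : ∀ u v → BraidAtHead u v → Braid u v
  BraidAtHead⇒Braid []      v       h = h
  BraidAtHead⇒Braid (x ∷ u) []      h = h
  BraidAtHead⇒Braid (x ∷ u) (y ∷ v) h = inj₁ h

  drop-alt : ∀ (s t : Fin n) k v → drop k (alt s t k ++ v) ≡ v
  drop-alt s t zero    v = refl
  drop-alt s t (suc k) v = drop-alt t s k v

  braid⇒Braid : ∀ u v {s t} → s ≢ t → Braid (u ++ alt s t (m s t) ++ v) (u ++ alt t s (m s t) ++ v)
  braid⇒Braid [] v {s} {t} s≢t = BraidAtHead⇒Braid _ _ (s , t , s≢t ,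
    cong (alt s t (m s t) ++_) (sym (drop-alt s t (m s t) v)) , cong (alt t s (m s t) ++_) (sym (drop-alt s t (m s t) v)))
  braid⇒Braid (x ∷ u) v s≢t = inj₂ (refl , braid⇒Braid u v s≢t)

  BraidEdge : Word n → Word n → Set
  BraidEdge u v = u ≡ v ⊎ Braid u v ⊎ Braid v u

  braidEdge? : ∀ u v → Dec (BraidEdge u v)
  braidEdge? u v = (u ≡? v) ⊎-dec (braid? u v ⊎-dec braid? v u)

  open Warshall BraidEdge braidEdge?

  BraidEdge-sym : ∀ {u v} → BraidEdge u v → BraidEdge v u
  BraidEdge-sym (inj₁ p) = inj₁ (sym p)
  BraidEdge-sym (inj₂ b) = inj₂ (⊎-swap b)

  BraidEdge⇒≈B : ∀ {u v} → BraidEdge u v → u ≈B v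
  BraidEdge⇒≈B (inj₁ p)        = ≡⇒≈B p
  BraidEdge⇒≈B (inj₂ (inj₁ b)) = Braid⇒≈B _ _ b
  BraidEdge⇒≈B (inj₂ (inj₂ b)) = symB (Braid⇒≈B _ _ b)

  ≈B⇒Reach : ∀ {l u v} → length u ≡ l → u ≈B v → Reach (words l) u v
  ≈B⇒Reach {l} len (braid u v s t s≢t) = reach-base (words l) (inj₂ (inj₁ (braid⇒Braid u v s≢t)))
  ≈B⇒Reach {l} len reflB               = reach-base (words l) (inj₁ refl)
  ≈B⇒Reach {l} len (symB p)            = reach-sym BraidEdge-sym (words l) (≈B⇒Reach (trans (length-≈B p) len) p)
  ≈B⇒Reach {l} len (transB {v = v} p q) = reach-trans (subst (λ k → v ∈ words k) len-v (∈-words v)) (≈B⇒Reach len p) (≈B⇒Reach len-v q)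
    where
    len-v : length v ≡ l
    len-v = trans (sym (length-≈B p)) len

  _≈B?_ : ∀ u v → Dec (u ≈B v)
  u ≈B? v = map′ (reach-sound _≈B_ BraidEdge⇒≈B transB (words (length u))) (≈B⇒Reach refl) (reach? (words (length u)) u v)

  _≼?_ : ∀ u w → Dec (u ≼ w)
  u ≼? w = map′ Any.satisfied complete (Any.any? (λ v → (u ++ v) ≈B? w) (words (length w ∸ length u)))
    where
    complete : u ≼ w → Any (λ v → u ++ v ≈B w) (words (length w ∸ length u))
    complete (v , p) = lose (subst (λ k → v ∈ words k) len (∈-words v)) p
      where
      len : length v ≡ length w ∸ length u
      len = sym (trans (cong (_∸ length u) (trans (sym (length-≈B p)) (length-++ u))) (ℕₚ.m+n∸m≡n (length u) (length v)))

  ¬¬-All : ∀ {A : Set} {P : A → Set} → (∀ x → ¬ ¬ P x) → ∀ xs → ¬ ¬ All P xs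
  ¬¬-All f []       k = k []
  ¬¬-All f (x ∷ xs) k = f x λ p → ¬¬-All f xs λ ps → k (p ∷ ps)

  -- Equality of finitely many representatives is decidable up to double negation.
  ¬¬-≈W? : IsFiniteW → ¬ ¬ (∀ u v → Dec (u ≈W v))
  ¬¬-≈W? (L , cover) k = ¬¬-All (λ a → ¬¬-All (λ b → ¬¬-excluded-middle {A = a ≈W b}) L) L λ table → k λ u v →
      let a , a∈L , u≈a = find (cover u)
          b , b∈L , v≈b = find (cover v)
      in map′ (λ p → transW u≈a (transW p (symW v≈b))) (λ p → transW (symW u≈a) (transW p v≈b))
              (All.lookup (All.lookup table a∈L) b∈L)

-- Lattice structure and duality

module Garside {n : ℕ} (M : CoxeterMatrix n) (finite : Coxeter.IsFiniteW M)
  (w₀ : Word n) (longest : Coxeter.IsLongestReduced M w₀) where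
  open Artin M
  open Decidability M
  open Divisibility M

  w₀-palindrome : reverse w₀ ≈B w₀
  w₀-palindrome = decidable-stable (reverse w₀ ≈B? w₀) λ k → ¬¬-≈W? finite λ dec →
    k (ReducedWords.Longest.w₀-palindrome M dec w₀ longest)

  reduct : ∀ {s u t v} → s ∷ u ≈B t ∷ v → Reduct s u t v
  reduct {s} {u} {t} {v} p with s ≟ t
  ... | yes refl = inj₁ (refl , decidable-stable (u ≈B? v) λ k → ¬¬-≈W? finite λ dec →
                     k (same (Reduction.reduct M dec w₀ longest p)))
    where
    same : Reduct s u s v → u ≈B v
    same (inj₁ (_ , q))   = q
    same (inj₂ (s≢s , _)) = contradiction refl s≢s
  ... | no  s≢t  = inj₂ (s≢t , w , symB a₁w≈u , symB a₂w≈v)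
    where
    distinct : Reduct s u t v → alt t s (m′ s t) ≼ u
    distinct (inj₁ (s≡t , _))       = contradiction s≡t s≢t
    distinct (inj₂ (_ , w , q , _)) = w , symB q
    -- A witness cannot be taken out of a double negation; but divisibility is decidable, and its
    -- decision procedure supplies the cofactor `w`. That `w` also fits `v` then follows by
    -- cancelling t.
    a₁≼u : alt t s (m′ s t) ≼ u
    a₁≼u = decidable-stable (alt t s (m′ s t) ≼? u) λ k → ¬¬-≈W? finite λ dec →
      k (distinct (Reduction.reduct M dec w₀ longest p))
    w : Word n
    w = proj₁ a₁≼u
    a₁w≈u : alt t s (m′ s t) ++ w ≈B u
    a₁w≈u = proj₂ a₁≼u
    same : ∀ {x y} → Reduct t x t y → x ≈B y
    same (inj₁ (_ , q))   = q
    same (inj₂ (t≢t , _)) = contradiction refl t≢t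
    a₂w≈v : alt s t (m′ s t) ++ w ≈B v
    a₂w≈v = decidable-stable ((alt s t (m′ s t) ++ w) ≈B? v) λ k → ¬¬-≈W? finite λ dec →
      k (same (Reduction.reduct M dec w₀ longest (transB (symB (braid-alt s≢t w)) (transB (++-congˡB [ s ] a₁w≈u) p))))

  open LCM (λ _ → ⊤) (λ _ _ → tt) (λ _ → tt) (λ _ → reduct) public using (Lcm; module Lcm; lcm; ++-cancel; ++-cancel-≼)

  ++-cancelˡB : ∀ x {u v} → x ++ u ≈B x ++ v → u ≈B v
  ++-cancelˡB x = ++-cancel x tt

  reverse-injectiveB : ∀ {u v} → reverse u ≈B reverse v → u ≈B v
  reverse-injectiveB {u} {v} p = subst₂ _≈B_ (reverse-involutive u) (reverse-involutive v) (reverse-≈B p)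

  record Gcd (a b : Word n) : Set where
    field
      meet     : Word n
      left     : meet ≼ a
      right    : meet ≼ b
      greatest : ∀ d → d ≼ a → d ≼ b → d ≼ meet

  gcd-resp : ∀ {a b a′ b′} → a ≈B a′ → b ≈B b′ → Gcd a b → Gcd a′ b′
  gcd-resp p q g = record
    { meet = meet ; left = ≼-respʳ left p ; right = ≼-respʳ right q
    ; greatest = λ d d≼a d≼b → greatest d (≼-respʳ d≼a (symB p)) (≼-respʳ d≼b (symB q)) }
    where open Gcd g

  -- A common divisor d need not begin with s, but s and d have an lcm s c below s a, and by
  -- leastness below s b too. Then c divides a and b, and d divides s c.
  gcd-∷ : ∀ {s a b} → Gcd a b → Gcd (s ∷ a) (s ∷ b)
  gcd-∷ {s} {a} {b} g = record
    { meet = s ∷ meet ; left = ++-≼ [ s ] left ; right = ++-≼ [ s ] right ; greatest = greatest′ }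
    where
    open Gcd g
    greatest′ : ∀ d → d ≼ s ∷ a → d ≼ s ∷ b → d ≼ s ∷ meet
    greatest′ d d≼sa d≼sb = ≼-trans (Lcm.right D) (≼-respˡ (symB sc≈D) (++-≼ [ s ] (greatest c
        (++-cancel-≼ [ s ] tt (≼-respˡ sc≈D (Lcm.below D)))
        (++-cancel-≼ [ s ] tt (≼-respˡ sc≈D (Lcm.least D (s ∷ b) tt (≼-++ [ s ] b) d≼sb))))))
      where
      D : Lcm [ s ] d (s ∷ a)
      D = lcm [ s ] d (s ∷ a) tt (≼-++ [ s ] a) d≼sa
      c : Word n
      c = proj₁ (Lcm.left D)
      sc≈D : s ∷ c ≈B Lcm.join D
      sc≈D = proj₂ (Lcm.left D)

  gcd : ∀ a b → Gcd a b
  gcd a b = gcd-fuel (length a) a b ℕₚ.≤-refl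
    where
    gcd-fuel : ∀ l a b → length a ≤ l → Gcd a b
    gcd-fuel l a b len with any? (λ s → ([ s ] ≼? a) ×-dec ([ s ] ≼? b))
    gcd-fuel l a b len | no none = record
      { meet = [] ; left = []-≼ a ; right = []-≼ b ; greatest = λ
        { []      _   _   → []-≼ []
        ; (s ∷ d) d≼a d≼b → contradiction (s , ≼-trans (≼-++ [ s ] d) d≼a , ≼-trans (≼-++ [ s ] d) d≼b) none } }
    gcd-fuel zero    a b len | yes (s , (a′ , p) , _) = contradiction (subst (_≤ 0) (sym (length-≈B p)) len) λ ()
    gcd-fuel (suc l) a b len | yes (s , (a′ , p) , (b′ , q)) =
      gcd-resp p q (gcd-∷ (gcd-fuel l a′ b′ (ℕ.s≤s⁻¹ (subst (_≤ suc l) (sym (length-≈B p)) len))))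

  module WeakOrder (k : ℕ) where
    open Interval w₀ k

    isLattice : IsLattice
    isLattice a b a≼top b≼top =
      (Gcd.meet g , ≼-trans (Gcd.left g) a≼top , Gcd.left g , Gcd.right g , λ d _ → Gcd.greatest g d) ,
      (Lcm.join j , Lcm.below j , Lcm.left j , Lcm.right j , λ d _ → Lcm.least j d tt)
      where
      g : Gcd a b
      g = gcd a b
      j : Lcm a b top
      j = lcm a b top tt a≼top b≼top

    power-cong : ∀ {u v} k → u ≈B v → power u k ≈B power v k
    power-cong zero        p = reflB
    power-cong {u} {v} (suc k) p = transB (++-congʳB (power u k) p) (++-congˡB v (power-cong k p))

    power-∷ʳ : ∀ (u : Word n) k → power u k ++ u ≡ u ++ power u k
    power-∷ʳ u zero    = sym (++-identityʳ u)
    power-∷ʳ u (suc k) = trans (++-assoc u (power u k) u) (cong (u ++_) (power-∷ʳ u k))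

    reverse-power : ∀ (u : Word n) k → reverse (power u k) ≡ power (reverse u) k
    reverse-power u zero    = refl
    reverse-power u (suc k) = trans (reverse-++ u (power u k)) (trans (cong (_++ reverse u) (reverse-power u k)) (power-∷ʳ (reverse u) k))

    length-power : ∀ (u : Word n) k → length (power u k) ≡ k ℕ.* length u
    length-power u zero    = refl
    length-power u (suc k) = trans (length-++ u) (cong (length u ℕ.+_) (length-power u k))

    top-palindrome : reverse top ≈B top
    top-palindrome = transB (≡⇒≈B (reverse-power w₀ k)) (power-cong k w₀-palindrome)

    reverse-top : ∀ {x v} → x ++ v ≈B top → reverse v ++ reverse x ≈B top
    reverse-top {x} {v} p = transB (≡⇒≈B (sym (reverse-++ x v))) (transB (reverse-≈B p) top-palindrome)

    -- The complement v of x in x v = w₀ᵏ reverses the order from left to right divisibility, and word reversal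
    -- turns right divisibility back into left divisibility.
    dual : Elt → Elt
    dual (x , v , p) = reverse v , reverse x , reverse-top {x} {v} p

    complement-cong : ∀ (x y : Elt) → proj₁ x ≈B proj₁ y → proj₁ (proj₂ x) ≈B proj₁ (proj₂ y)
    complement-cong (x , v , p) (y , w , q) x≈y =
      ++-cancelˡB x (transB p (transB (symB q) (++-congʳB w (symB x≈y))))

    dual-cong : ∀ x y → proj₁ x ≈B proj₁ y → proj₁ (dual x) ≈B proj₁ (dual y)
    dual-cong x y x≈y = reverse-≈B (complement-cong x y x≈y)

    -- The complement stored in `dual x` is `reverse x`, so uniqueness of complements recovers x.
    dual-injective : ∀ x y → proj₁ (dual x) ≈B proj₁ (dual y) → proj₁ x ≈B proj₁ y
    dual-injective x y p = reverse-injectiveB (complement-cong (dual x) (dual y) p)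

    dual-involutive : ∀ x → proj₁ (dual (dual x)) ≈B proj₁ x
    dual-involutive (x , _) = ≡⇒≈B (reverse-involutive x)

    dual-antitone : ∀ (x y : Elt) → proj₁ x ≼ proj₁ y → proj₁ (dual y) ≼ proj₁ (dual x)
    dual-antitone (x , v , p) (y , w , q) (z , xz≈y) =
      reverse z , transB (≡⇒≈B (sym (reverse-++ z w))) (reverse-≈B (symB v≈zw))
      where
      v≈zw : v ≈B z ++ w
      v≈zw = ++-cancelˡB x (transB p (transB (symB q) (transB (++-congʳB w (symB xz≈y)) (≡⇒≈B (++-assoc x z w)))))

    dual-reflects : ∀ (x y : Elt) → proj₁ (dual y) ≼ proj₁ (dual x) → proj₁ x ≼ proj₁ y
    dual-reflects x y p = ≼-respˡ (symB (dual-involutive x)) (≼-respʳ (dual-antitone (dual y) (dual x) p) (dual-involutive y))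

    selfDual : SelfDual
    selfDual = dual , dual-cong , dual-injective , (λ y → dual y , dual-involutive y) ,
               λ x y → mk⇔ (dual-antitone x y) (dual-reflects x y)

    length-dual : ∀ (x : Elt) → length (proj₁ (dual x)) ≡ rank ∸ length (proj₁ x)
    length-dual (x , v , p) = begin
      length (reverse v)                        ≡⟨ length-reverse v ⟩
      length v                                  ≡⟨ ℕₚ.m+n∸m≡n (length x) (length v) ⟨
      length x ℕ.+ length v ∸ length x          ≡⟨ cong (_∸ length x) (trans (sym (length-++ x)) (trans (length-≈B p) (length-power w₀ k))) ⟩
      rank ∸ length x                           ∎
      where open ≡-Reasoning

    rankSymmetric : RankSymmetric
    rankSymmetric i i≤rank = record
      { to        = λ (x , x≼top , len) → let y , y≼top = dual (x , x≼top) in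
                      y , y≼top , trans (length-dual (x , x≼top)) (cong (rank ∸_) len)
      ; cong      = λ { {x , x≼top , _} {y , y≼top , _} → dual-cong (x , x≼top) (y , y≼top) }
      ; bijective = (λ { {x , x≼top , _} {y , y≼top , _} → dual-injective (x , x≼top) (y , y≼top) }) ,
                    λ (y , y≼top , len) → let x , x≼top = dual (y , y≼top) in
                      (x , x≼top , trans (length-dual (y , y≼top)) (trans (cong (rank ∸_) len) (ℕₚ.m∸[m∸n]≡n i≤rank))) ,
                      λ { {z , z≼top , _} z≈x → transB (dual-cong (z , z≼top) (x , x≼top) z≈x) (dual-involutive (y , y≼top)) }
      }

mainTheorem1 : ∀ {n : ℕ} (M : CoxeterMatrix n) →
    let open Coxeter M in
    IsFiniteW → (w0 : Word n) → IsLongestReduced w0 → (k : ℕ) →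
    let open Interval w0 k in
    IsLattice × RankSymmetric × SelfDual
mainTheorem1 M finite w0 longest k = isLattice , rankSymmetric , selfDual
  where open Garside.WeakOrder M finite w0 longest k
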